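{- For every $\mu>0$ there exist constants $0<c,\varepsilon\le 1$ and $n_0\in\mathbb N$ such that the following holds for all $n\ge n_0$. If $G$ is an $n$-vertex graph that is $\varepsilon n$-joined and has minimum degree $\delta(G)\ge \mu n$, then $G$ contains a spanning nearly-balanced $K_t$-subdivision for all integers $t$ with $2\le t\le c\sqrt{n}$.
   Context: For $m>0$, a graph $G$ is $m$-joined if for every pair of disjoint subsets $A,B\subseteq V(G)$ with $|A|=|B|=m$ there is an edge of $G$ between $A$ and $B$. For a graph $H$, an $H$-subdivision is a graph obtained from $H$ by replacing some (possibly all) edges of $H$ by paths, these paths being internally vertex-disjoint from each other and from the vertices of $H$; the images of the vertices of $H$ are the branch vertices and the paths replacing edges are the branching paths. A subdivision contained in $G$ is spanning if it uses all vertices of $G$. An $H$-subdivision is nearly-balanced if there is a positive integer $\ell$ such that every branching path has length between $\ell-1$ and $\ell+1$. $K_t$ denotes the complete graph on $t$ vertices. -}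

module Defs where

open import Data.Nat using (ℕ; zero; suc; _+_; _∸_; _<_; _≤_)
open import Data.Bool using (Bool; true; false; if_then_else_)
open import Data.Fin using (Fin)
import Data.Fin as F
open import Data.Fin.Subset using (Subset; _∈_; ∣_∣)
open import Data.List using (List; []; _∷_; _++_; [_]; length; map; allFin)
open import Data.Nat.ListAction using (sum)
import Data.List.Membership.Propositional as LM
open import Data.List.Relation.Unary.Unique.Propositional using (Unique)
open import Data.Product using (Σ; ∃; ∃-syntax; _×_; _,_)
open import Data.Sum using (_⊎_)
open import Data.Unit using (⊤)
open import Data.Empty using (⊥)
open import Relation.Binary.PropositionalEquality using (_≡_; _≢_)
open import Function.Definitions using (Injective)

record Graph (n : ℕ) : Set where
  field
    adj   : Fin n → Fin n → Bool
    sym   : ∀ u v → adj u v ≡ adj v u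
    loopless : ∀ v → adj v v ≡ false

open Graph public

Edge : ∀ {n} → Graph n → Fin n → Fin n → Set
Edge G u v = adj G u v ≡ true

degree : ∀ {n} → Graph n → Fin n → ℕ
degree {n} G v = sum (map (λ w → if adj G v w then 1 else 0) (allFin n))

Disjoint : ∀ {n} → Subset n → Subset n → Set
Disjoint A B = ∀ x → x ∈ A → x ∈ B → ⊥

Joined : ∀ {n} → Graph n → ℕ → Set
Joined {n} G m = (0 < m) × (∀ (A B : Subset n) → Disjoint A B → ∣ A ∣ ≡ m → ∣ B ∣ ≡ m →
  ∃[ a ] ∃[ b ] (a ∈ A × b ∈ B × Edge G a b))

Walk : ∀ {n} → Graph n → List (Fin n) → Set
Walk G [] = ⊤
Walk G (x ∷ []) = ⊤
Walk G (x ∷ y ∷ r) = Edge G x y × Walk G (y ∷ r)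

record KSubdivision {n} (G : Graph n) (t : ℕ) : Set where
  field
    branch   : Fin t → Fin n
    branch-injective : Injective _≡_ _≡_ branch
    internal : Fin t → Fin t → List (Fin n)
    path-walk : ∀ i j → i F.< j → Walk G (branch i ∷ internal i j ++ [ branch j ])
    internal-unique : ∀ i j → i F.< j → Unique (internal i j)
    internal-not-branch : ∀ i j → i F.< j → ∀ v → v LM.∈ internal i j → ∀ k → v ≢ branch k
    internally-disjoint : ∀ i j i' j' → i F.< j → i' F.< j' → ∀ v →
      v LM.∈ internal i j → v LM.∈ internal i' j' → (i ≡ i') × (j ≡ j')

open KSubdivision public

pathLength : ∀ {n} {G : Graph n} {t} → KSubdivision G t → Fin t → Fin t → ℕ
pathLength S i j = suc (length (internal S i j))

Spanning : ∀ {n} {G : Graph n} {t} → KSubdivision G t → Set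
Spanning {n} {G} {t} S = ∀ (v : Fin n) →
  (∃[ k ] branch S k ≡ v) ⊎ (∃[ i ] ∃[ j ] (i F.< j × v LM.∈ internal S i j))

NearlyBalanced : ∀ {n} {G : Graph n} {t} → KSubdivision G t → Set
NearlyBalanced {t = t} S = Σ ℕ λ ℓ → (0 < ℓ) × (∀ i j → i F.< j →
  (ℓ ∸ 1 ≤ pathLength S i j) × (pathLength S i j ≤ ℓ + 1))

module Submission where

-- Say μ ≥ 1/m. For every pair ij we greedily build a path Q_ij from the branch vertex v_i, made of
-- slots. A slot is a concatenation of boundedly many blocks, each of which can absorb any common
-- neighbour of two designated vertices a, b; averaging over the choices of a and b, one slot absorbs all
-- but a tiny proportion of a reservoir R of linear size in which every vertex has linearly many
-- neighbours. The vertices outside the branch vertices, the Q_ij and R span a Hamilton path, because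
-- a path in a joined graph of large minimum degree can be extended, rotated, or have an outside vertex
-- inserted. This Hamilton path is cut into pieces W_ij whose lengths differ by at most one, and each
-- Q_ij, W_ij and v_j are linked by edges through R. The sizes are such that as many vertices of R remain as
-- there are slots; since almost all of these vertices and slots are compatible, they have a perfect
-- matching, and absorbing along it makes the subdivision spanning without upsetting its balance.

open import Defs

-- Which reservoir vertices survive the linking is not known when the slots are built, so every slot
-- must cope with almost all of them. A single pair a, b guarantees only a proportion of about 1/4m²
-- as common neighbours; hence a slot has many blocks, each aimed at what the earlier ones missed. A
-- slot takes in exactly one vertex, whichever it is, so under any perfect matching every path gains
-- the same number of vertices. Only the cutting of the Hamilton path makes lengths differ, and by
-- at most one. The matching needs exactly as many vertices as slots, each compatible with most of
-- the other side. The initial reservoir is therefore oversized: vertices missed by too many slots,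
-- and the excess left by rounding, are discarded. The Hamilton path collects them, since no
-- particular length is asked of it. Joinedness yields edges only between sets of linear size, so
-- two given vertices are connected through an edge between their neighbourhoods. All random choices
-- are replaced by greedy ones, justified by averaging.

module Combinatorics where

  open import Axiom.UniquenessOfIdentityProofs.WithK using (uip)
  open import Data.Bool using (Bool; true; false; if_then_else_)
  import Data.Bool.Properties as Bool
  open import Data.Empty using (⊥; ⊥-elim)
  open import Data.Fin using (Fin; zero; suc; inject≤)
  import Data.Fin as F
  import Data.Fin.Properties as Fin
  open import Data.Fin.Subset using (Subset; ∣_∣; inside; outside) renaming (_∈_ to _∈ₛ_; ⊥ to ∅)
  open import Data.Fin.Subset.Properties using (∣⊥∣≡0; ∉⊥)
  open import Data.List using (List; []; _∷_; _++_; [_]; length; map; filter; take; drop; allFin; reverse; concatMap; cartesianProduct)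
  open import Data.List.Membership.Propositional using (_∈_; _∉_; find)
  open import Data.List.Membership.Propositional.Properties using (∈-∃++; ∈-++⁺ˡ; ∈-++⁺ʳ; ∈-++⁻; ∈-filter⁺; ∈-filter⁻; ∈-map⁺; ∈-map⁻; ∈-allFin; ∈-cartesianProduct⁺)
  open import Data.List.Properties using (length-++; length-map; filter-++; length-filter; filter-none; filter-≐; unfold-reverse; length-tabulate; ++-assoc; ++-identityʳ; concatMap-++; take++drop≡id)
  open import Data.List.Relation.Binary.Permutation.Propositional using (_↭_; ↭⇒↭ₛ; ↭-sym; ↭-trans; ↭-refl; ↭-reflexive; prep; swap)
  open import Data.List.Relation.Binary.Permutation.Propositional.Properties using (shift; shifts; ↭-length; ∈-resp-↭; All-resp-↭; filter-↭; ++⁺; ++⁺ˡ; ++⁺ʳ; ↭-reverse; ++-comm; ↭-map-inv; ++-commutativeMonoid) renaming (map⁺ to ↭-map)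
  open import Data.List.Relation.Binary.Permutation.Setoid.Properties using (Unique-resp-↭)
  open import Data.List.Relation.Binary.Pointwise using (Pointwise; []; _∷_)
  open import Data.List.Relation.Unary.All as All using (All; []; _∷_)
  import Data.List.Relation.Unary.All.Properties as AllP
  open import Data.List.Relation.Unary.AllPairs using ([]; _∷_)
  open import Data.List.Relation.Unary.Any using (Any; here; there; any?)
  open import Data.List.Relation.Unary.Unique.Propositional using (Unique)
  import Data.List.Relation.Unary.Unique.Propositional.Properties as UniqueP
  open import Data.Nat
  open import Data.Nat.DivMod using (m≡m%n+[m/n]*n; m%n<n; m≥n⇒m/n>0; m/n*n≤m; m*n/n≡m; /-monoˡ-≤)
  open import Data.Nat.ListAction using (sum)
  open import Data.Nat.Properties
  open import Data.Nat.Tactic.RingSolver using (solve-∀)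
  open import Data.Product using (Σ; ∃-syntax; _×_; _,_; proj₁; proj₂)
  open import Data.Sum using (_⊎_; inj₁; inj₂; [_,_]′)
  open import Data.Unit using (tt)
  open import Data.Vec using (_[_]≔_; lookup; _∷_)
  open import Data.Vec.Properties using (lookup∘update′; []=⇒lookup; lookup⇒[]=)
  open import Level using (Level)
  open import Relation.Binary using (REL; Decidable)
  open import Relation.Binary.PropositionalEquality as ≡ using (_≡_; _≢_; refl; cong; cong₂; subst)
  open import Relation.Nullary using (¬_; Dec; yes; no; contradiction)
  open import Relation.Nullary.Decidable using (¬?; decidable-stable; _×-dec_)

  private variable
    ℓ₁ ℓ₂ ℓ₃ : Level
    A : Set ℓ₁
    B : Set ℓ₂

  -- Lists and sums

  -- Certificate form of linear arithmetic: from S ≤ T and one semiring identity.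
  linear : ∀ {x y S T} slack → S ≤ T → x + T + slack ≡ y + S → x ≤ y
  linear {x} {y} {S} {T} slack S≤T eq = +-cancelʳ-≤ T x y (begin
    x + T         ≤⟨ m≤m+n (x + T) slack ⟩
    x + T + slack ≡⟨ eq ⟩
    y + S         ≤⟨ +-monoʳ-≤ y S≤T ⟩
    y + T         ∎)
    where open ≤-Reasoning

  unique-resp : ∀ {xs ys : List A} → xs ↭ ys → Unique xs → Unique ys
  unique-resp xs↭ys = Unique-resp-↭ (≡.setoid _) (↭⇒↭ₛ xs↭ys)

  extract : ∀ {x : A} {xs} → x ∈ xs → ∃[ ys ] xs ↭ x ∷ ys
  extract {x = x} x∈xs with ps , qs , refl ← ∈-∃++ x∈xs = ps ++ qs , shift x ps qs

  unique-head : ∀ {x : A} {xs} → Unique (x ∷ xs) → x ∉ xs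
  unique-head = UniqueP.Unique[x∷xs]⇒x∉xs

  unique-cons : ∀ {x : A} {xs} → x ∉ xs → Unique xs → Unique (x ∷ xs)
  unique-cons {x = x} {xs} x∉ u = All.tabulate (λ {y} y∈ x≡y → x∉ (subst (_∈ xs) (≡.sym x≡y) y∈)) ∷ u

  unique-tail : ∀ {x : A} {xs} → Unique (x ∷ xs) → Unique xs
  unique-tail (_ ∷ u) = u

  unique-++⁻ʳ : ∀ (xs : List A) {ys} → Unique (xs ++ ys) → Unique ys
  unique-++⁻ʳ []       u       = u
  unique-++⁻ʳ (_ ∷ xs) (_ ∷ u) = unique-++⁻ʳ xs u

  unique-++⁻ˡ : ∀ (xs : List A) {ys} → Unique (xs ++ ys) → Unique xs
  unique-++⁻ˡ []       u        = []
  unique-++⁻ˡ (_ ∷ xs) (px ∷ u) = AllP.++⁻ˡ xs px ∷ unique-++⁻ˡ xs u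

  unique-disjoint : ∀ (xs : List A) {ys z} → Unique (xs ++ ys) → z ∈ xs → z ∈ ys → ⊥
  unique-disjoint (x ∷ xs) u (here refl) z∈ys = unique-head u (∈-++⁺ʳ xs z∈ys)
  unique-disjoint (x ∷ xs) u (there z∈xs) z∈ys = unique-disjoint xs (unique-tail u) z∈xs z∈ys

  unique-++ : ∀ {xs ys : List A} → Unique xs → Unique ys → (∀ {z} → z ∈ xs → z ∉ ys) → Unique (xs ++ ys)
  unique-++ u v d = UniqueP.++⁺ u v (λ (i , j) → d i j)

  ∈-tail : ∀ {x z : A} {xs} → z ∈ x ∷ xs → z ≢ x → z ∈ xs
  ∈-tail (here z≡x) z≢x = contradiction z≡x z≢x
  ∈-tail (there z∈) z≢x = z∈

  unique-⊆-length : ∀ {xs ys : List A} → Unique xs → (∀ {z} → z ∈ xs → z ∈ ys) → length xs ≤ length ys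
  unique-⊆-length {xs = []}     u s = z≤n
  unique-⊆-length {xs = x ∷ xs} {ys} u s with ys′ , ys↭ ← extract (s (here refl)) = begin
    suc (length xs)  ≤⟨ s≤s (unique-⊆-length (unique-tail u) λ z∈ →
                          ∈-tail (∈-resp-↭ ys↭ (s (there z∈))) λ { refl → unique-head u z∈ }) ⟩
    suc (length ys′) ≡⟨ ↭-length (↭-sym ys↭) ⟩
    length ys        ∎
    where open ≤-Reasoning

  -- A repetition would leave too few positions to cover all of `ys`. This carries freshness from
  -- the order in which the vertices of a block are chosen to their order along the path, with a map
  -- of memberships in place of an explicit permutation.
  covering-unique : ∀ {xs ys : List A} → Unique ys → (∀ {z} → z ∈ ys → z ∈ xs) → length xs ≤ length ys → Unique xs
  covering-unique {xs = []} {ys = []} u s l = []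
  covering-unique {xs = xs} {ys = y ∷ ys} u s l with xs′ , xs↭ ← extract (s (here refl)) =
    unique-resp (↭-sym xs↭) (unique-cons y∉xs′ (covering-unique (unique-tail u) ys⊆xs′ xs′≤ys))
    where
    ys⊆xs′ : ∀ {z} → z ∈ ys → z ∈ xs′
    ys⊆xs′ z∈ = ∈-tail (∈-resp-↭ xs↭ (s (there z∈))) λ { refl → unique-head u z∈ }
    xs′≤ys : length xs′ ≤ length ys
    xs′≤ys = s≤s⁻¹ (≤-trans (≤-reflexive (↭-length (↭-sym xs↭))) l)
    y∉xs′ : y ∉ xs′
    y∉xs′ y∈ = 1+n≰n (≤-trans (unique-⊆-length u λ { (here refl) → y∈ ; (there z∈) → ys⊆xs′ z∈ }) xs′≤ys)

  length-filter-∁ : ∀ {P : A → Set ℓ₃} (P? : ∀ x → Dec (P x)) xs →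
    length (filter P? xs) + length (filter (λ x → ¬? (P? x)) xs) ≡ length xs
  length-filter-∁ P? [] = refl
  length-filter-∁ P? (x ∷ xs) with P? x
  ... | yes _ = cong suc (length-filter-∁ P? xs)
  ... | no _  = ≡.trans (+-suc _ _) (cong suc (length-filter-∁ P? xs))

  filter-∁-↭ : ∀ {P : A → Set ℓ₃} (P? : ∀ x → Dec (P x)) xs →
    filter P? xs ++ filter (λ x → ¬? (P? x)) xs ↭ xs
  filter-∁-↭ P? [] = ↭-refl
  filter-∁-↭ P? (x ∷ xs) with P? x
  ... | yes _ = prep x (filter-∁-↭ P? xs)
  ... | no _  = ↭-trans (shift x (filter P? xs) _) (prep x (filter-∁-↭ P? xs))

  take-⊆ : ∀ k {xs : List A} {z} → z ∈ take k xs → z ∈ xs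
  take-⊆ (suc k) {x ∷ xs} (here z≡) = here z≡
  take-⊆ (suc k) {x ∷ xs} (there z∈) = there (take-⊆ k z∈)

  unique-take : ∀ k {xs : List A} → Unique xs → Unique (take k xs)
  unique-take k u = UniqueP.take⁺ k u

  length-take-≤ : ∀ k (xs : List A) → k ≤ length xs → length (take k xs) ≡ k
  length-take-≤ zero xs l = refl
  length-take-≤ (suc k) (x ∷ xs) (s≤s l) = cong suc (length-take-≤ k xs l)

  length-positive : ∀ {xs : List A} → 0 < length xs → ∃[ x ] x ∈ xs
  length-positive {xs = x ∷ _} _ = x , here refl

  Σ[_] : List A → (A → ℕ) → ℕ
  Σ[ xs ] f = sum (map f xs)

  Σ-mono : ∀ (xs : List A) {f g : A → ℕ} → (∀ {x} → x ∈ xs → f x ≤ g x) → Σ[ xs ] f ≤ Σ[ xs ] g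
  Σ-mono [] h = z≤n
  Σ-mono (x ∷ xs) h = +-mono-≤ (h (here refl)) (Σ-mono xs (λ i → h (there i)))

  Σ-cong : ∀ (xs : List A) {f g : A → ℕ} → (∀ x → f x ≡ g x) → Σ[ xs ] f ≡ Σ[ xs ] g
  Σ-cong [] h = refl
  Σ-cong (x ∷ xs) h = cong₂ _+_ (h x) (Σ-cong xs h)

  Σ-* : ∀ k (xs : List A) (f : A → ℕ) → Σ[ xs ] (λ x → k * f x) ≡ k * Σ[ xs ] f
  Σ-* k [] f = ≡.sym (*-zeroʳ k)
  Σ-* k (x ∷ xs) f = ≡.trans (cong (k * f x +_) (Σ-* k xs f)) (≡.sym (*-distribˡ-+ k (f x) _))

  Σ-+ : ∀ (xs : List A) (f g : A → ℕ) → Σ[ xs ] (λ x → f x + g x) ≡ Σ[ xs ] f + Σ[ xs ] g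
  Σ-+ [] f g = refl
  Σ-+ (x ∷ xs) f g = ≡.trans (cong (f x + g x +_) (Σ-+ xs f g)) (lem (f x) (g x) _ _)
    where
    lem : ∀ a b c d → a + b + (c + d) ≡ a + c + (b + d)
    lem = solve-∀

  Σ-const : ∀ k (xs : List A) → Σ[ xs ] (λ _ → k) ≡ length xs * k
  Σ-const k [] = refl
  Σ-const k (x ∷ xs) = cong (k +_) (Σ-const k xs)

  Σ-swap : ∀ (xs : List A) (ys : List B) (f : A → B → ℕ) →
    Σ[ xs ] (λ x → Σ[ ys ] (f x)) ≡ Σ[ ys ] (λ y → Σ[ xs ] (λ x → f x y))
  Σ-swap [] ys f = ≡.sym (≡.trans (Σ-const 0 ys) (*-zeroʳ (length ys)))
  Σ-swap (x ∷ xs) ys f = ≡.trans (cong (Σ[ ys ] (f x) +_) (Σ-swap xs ys f)) (≡.sym (Σ-+ ys (f x) _))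

  ∈-Σ-≤ : ∀ {xs : List A} {x} (f : A → ℕ) → x ∈ xs → f x ≤ Σ[ xs ] f
  ∈-Σ-≤ f (here refl) = m≤m+n _ _
  ∈-Σ-≤ f (there {x} i) = ≤-trans (∈-Σ-≤ f i) (m≤n+m _ (f x))

  exists-≥-average : ∀ (xs : List A) (f : A → ℕ) c → 0 < length xs → length xs * c ≤ Σ[ xs ] f →
    ∃[ x ] (x ∈ xs × c ≤ f x)
  exists-≥-average (x ∷ xs) f c l s with c ≤? f x
  ... | yes p = x , here refl , p
  exists-≥-average (x ∷ []) f c l s | no ¬p = contradiction (≤-trans (≤-reflexive (≡.sym (+-identityʳ c))) (≤-trans s (≤-reflexive (+-identityʳ (f x))))) ¬p
  exists-≥-average (x ∷ xs@(_ ∷ _)) f c l s | no ¬p =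
    let y , y∈ , q = exists-≥-average xs f c (s≤s z≤n) (+-cancelˡ-≤ c _ _ (≤-trans s (+-monoˡ-≤ _ (<⇒≤ (≰⇒> ¬p)))))
    in y , there y∈ , q

  ∃-outside : ∀ {P Q : A → Set ℓ₃} (P? : ∀ x → Dec (P x)) (Q? : ∀ x → Dec (Q x)) (xs : List A) →
    length (filter P? xs) + length (filter Q? xs) < length xs → ∃[ x ] (x ∈ xs × ¬ P x × ¬ Q x)
  ∃-outside P? Q? (x ∷ xs) l with P? x | Q? x
  ... | no ¬p | no ¬q = x , here refl , ¬p , ¬q
  ... | no ¬p | yes _ = let y , i , r = ∃-outside P? Q? xs (s≤s⁻¹ (≤-trans (≤-reflexive (cong suc (≡.sym (+-suc _ _)))) l)) in y , there i , r
  ... | yes _ | no _ = let y , i , r = ∃-outside P? Q? xs (s≤s⁻¹ l) in y , there i , r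
  ... | yes _ | yes _ = let y , i , r = ∃-outside P? Q? xs (≤-trans (s≤s (+-monoʳ-≤ _ (n≤1+n _))) (s≤s⁻¹ l)) in y , there i , r

  ∃-outside₁ : ∀ {P : A → Set ℓ₃} (P? : ∀ x → Dec (P x)) (xs : List A) →
    length (filter P? xs) < length xs → ∃[ x ] (x ∈ xs × ¬ P x)
  ∃-outside₁ P? (x ∷ xs) l with P? x
  ... | no ¬p = x , here refl , ¬p
  ... | yes _ = let y , i , r = ∃-outside₁ P? xs (s≤s⁻¹ l) in y , there i , r

  -- Decay estimates and matchings

  -- Bernoulli's inequality `(1 + 1/k) ^ j ≥ 1 + j/k`, cleared of denominators.
  bernoulli : ∀ k j → k ^ j * (k + j) ≤ k * suc k ^ j
  bernoulli k zero = ≤-reflexive (lem k)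
    where
    lem : ∀ k → 1 * (k + 0) ≡ k * 1
    lem = solve-∀
  bernoulli k (suc j) = begin
    k * k ^ j * (k + suc j)               ≤⟨ m≤m+n _ (k ^ j * j) ⟩
    k * k ^ j * (k + suc j) + k ^ j * j   ≡⟨ lem k j (k ^ j) ⟩
    suc k * (k ^ j * (k + j))             ≤⟨ *-monoʳ-≤ (suc k) (bernoulli k j) ⟩
    suc k * (k * suc k ^ j)               ≡⟨ lem₂ k (suc k ^ j) ⟩
    k * (suc k * suc k ^ j)               ∎
    where
    open ≤-Reasoning
    lem : ∀ k j x → k * x * (k + suc j) + x * j ≡ suc k * (x * (k + j))
    lem = solve-∀
    lem₂ : ∀ k x → suc k * (k * x) ≡ k * (suc k * x)
    lem₂ = solve-∀

  halving : ∀ k → 1 ≤ k → 2 * k ^ suc k ≤ suc k ^ suc k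
  halving k@(suc _) _ = *-cancelˡ-≤ k (begin
    k * (2 * k ^ suc k)       ≡⟨ lem k (k ^ suc k) ⟩
    k ^ suc k * (k + k)       ≤⟨ *-monoʳ-≤ (k ^ suc k) (+-monoʳ-≤ k (n≤1+n k)) ⟩
    k ^ suc k * (k + suc k)   ≤⟨ bernoulli k (suc k) ⟩
    k * suc k ^ suc k         ∎)
    where
    open ≤-Reasoning
    lem : ∀ k x → k * (2 * x) ≡ x * (k + k)
    lem = solve-∀

  ^-distribʳ : ∀ j x y → (x * y) ^ j ≡ x ^ j * y ^ j
  ^-distribʳ zero x y = refl
  ^-distribʳ (suc j) x y = ≡.trans (cong (x * y *_) (^-distribʳ j x y)) ([m*n]*[o*p]≡[m*o]*[n*p] x y (x ^ j) (y ^ j))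

  -- Reservoir and slots are both built in steps that gain a factor `k / (k + 1)`. As
  -- `(1 + 1/k) ^ (k + 1) ≥ 2`, every `k + 1` such steps halve the quantity.
  decay : ∀ k J {x y} → 1 ≤ k → suc k ^ (suc k * J) * x ≤ k ^ (suc k * J) * y → 2 ^ J * x ≤ y
  decay k@(suc _) J {x} {y} 1≤k hyp = *-cancelˡ-≤ P {{>-nonZero (m^n>0 k (suc k * J))}} (begin
    P * (2 ^ J * x)                   ≡⟨ lem P (2 ^ J) x ⟩
    2 ^ J * P * x                     ≡⟨ cong (λ z → 2 ^ J * z * x) (≡.sym (^-*-assoc k (suc k) J)) ⟩
    2 ^ J * (k ^ suc k) ^ J * x       ≡⟨ cong (_* x) (≡.sym (^-distribʳ J 2 (k ^ suc k))) ⟩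
    (2 * k ^ suc k) ^ J * x           ≤⟨ *-monoˡ-≤ x (^-monoˡ-≤ J (halving k 1≤k)) ⟩
    (suc k ^ suc k) ^ J * x           ≡⟨ cong (_* x) (^-*-assoc (suc k) (suc k) J) ⟩
    suc k ^ (suc k * J) * x           ≤⟨ hyp ⟩
    P * y                             ∎)
    where
    open ≤-Reasoning
    P = k ^ (suc k * J)
    lem : ∀ a b c → a * (b * c) ≡ b * a * c
    lem = solve-∀


  length-filter-map : ∀ {P : B → Set ℓ₃} (P? : ∀ x → Dec (P x)) (f : A → B) xs →
    length (filter (λ x → P? (f x)) xs) ≡ length (filter P? (map f xs))
  length-filter-map P? f [] = refl
  length-filter-map P? f (x ∷ xs) with P? (f x)
  ... | yes _ = cong suc (length-filter-map P? f xs)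
  ... | no _ = length-filter-map P? f xs

  length-filter-++ : ∀ {P : A → Set ℓ₃} (P? : ∀ x → Dec (P x)) xs ys →
    length (filter P? (xs ++ ys)) ≡ length (filter P? xs) + length (filter P? ys)
  length-filter-++ P? xs ys = ≡.trans (cong length (filter-++ P? xs ys)) (length-++ (filter P? xs))

  -- Of `s` elements on each side `z` are matched and `u` are not; `b` and `c` count the matched
  -- pairs unfit for an exchange because of `x` and of `y`, and `d` the unmatched elements
  -- incompatible with `x`. If `u ≤ d`, then `s = z + u ≤ b + c + d ≤ s/2`, so `s = 0`, against
  -- `1 ≤ u`.
  room : ∀ z u s b c d → z + u ≡ s → 1 ≤ u → z ≤ b + c → 4 * (b + d) ≤ s → 4 * c ≤ s → d < u
  room z u s b c d refl 1≤u z≤ bd c≤ with d <? u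
  ... | yes d<u = d<u
  ... | no d≮u = contradiction (linear {u} {0} (2 * z + u)
          (+-mono-≤ (+-mono-≤ (*-monoʳ-≤ 4 z≤) (*-monoʳ-≤ 4 (≮⇒≥ d≮u))) (+-mono-≤ bd c≤)) (lem z u b c d)) (<⇒≱ 1≤u)
    where
    lem : ∀ z u b c d → u + (4 * (b + c) + 4 * d + (z + u + (z + u))) + (2 * z + u) ≡ 4 * z + 4 * u + (4 * (b + d) + 4 * c)
    lem = solve-∀

  module Matching {ℓ₁ ℓ₂ ℓ₃ : Level} {A : Set ℓ₁} {B : Set ℓ₂} {Ok : REL A B ℓ₃} (ok? : Decidable Ok) (X : List A) (Y : List B)
    (|X|≡|Y| : length X ≡ length Y)
    (missX : ∀ {x} → x ∈ X → 4 * length (filter (λ y → ¬? (ok? x y)) Y) ≤ length Y)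
    (missY : ∀ {y} → y ∈ Y → 4 * length (filter (λ x → ¬? (ok? x y)) X) ≤ length Y)
    where

    private
      OkPair : A × B → Set _
      OkPair (x , y) = Ok x y

    unmatched-partner : ∀ Z {x y Xu Yu} → map proj₁ Z ++ x ∷ Xu ↭ X → map proj₂ Z ++ y ∷ Yu ↭ Y →
      length Z ≤ length (filter (λ z → ¬? (ok? x (proj₂ z))) Z) + length (filter (λ z → ¬? (ok? (proj₁ z) y)) Z) →
      ∃[ y′ ] (y′ ∈ y ∷ Yu × ¬ ¬ Ok x y′)
    unmatched-partner Z {x} {y} {Xu} {Yu} pX pY many = ∃-outside₁ (λ y → ¬? (ok? x y)) (y ∷ Yu)
      (room (length Z) (suc (length Yu)) (length Y) (length (filter (λ z → ¬? (ok? x (proj₂ z))) Z)) (length (filter (λ z → ¬? (ok? (proj₁ z) y)) Z)) (length (filter (λ y → ¬? (ok? x y)) (y ∷ Yu))) sizes (s≤s z≤n) many bx+bu≤ by≤)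
      where
      sizes : length Z + suc (length Yu) ≡ length Y
      sizes = ≡.trans (≡.sym (≡.trans (length-++ (map proj₂ Z)) (cong (_+ suc (length Yu)) (length-map proj₂ Z)))) (↭-length pY)
      bx+bu≤ : 4 * (length (filter (λ z → ¬? (ok? x (proj₂ z))) Z) + length (filter (λ y → ¬? (ok? x y)) (y ∷ Yu))) ≤ length Y
      bx+bu≤ = ≤-trans (≤-reflexive (cong (4 *_) (≡.trans (cong (_+ length (filter (λ y → ¬? (ok? x y)) (y ∷ Yu))) (length-filter-map (λ y → ¬? (ok? x y)) proj₂ Z))
        (≡.trans (≡.sym (length-filter-++ (λ y → ¬? (ok? x y)) (map proj₂ Z) (y ∷ Yu))) (↭-length (filter-↭ (λ y → ¬? (ok? x y)) pY))))))
        (missX (∈-resp-↭ pX (∈-++⁺ʳ (map proj₁ Z) (here refl))))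
      by≤ : 4 * length (filter (λ z → ¬? (ok? (proj₁ z) y)) Z) ≤ length Y
      by≤ = ≤-trans (*-monoʳ-≤ 4 (≤-trans (≤-reflexive (length-filter-map (λ x → ¬? (ok? x y)) proj₁ Z))
        (≤-trans (m≤m+n _ _) (≤-reflexive (≡.trans (≡.sym (length-filter-++ (λ x → ¬? (ok? x y)) (map proj₁ Z) (x ∷ Xu))) (↭-length (filter-↭ (λ x → ¬? (ok? x y)) pX)))))))
        (missY (∈-resp-↭ pY (∈-++⁺ʳ (map proj₂ Z) (here refl))))

    -- Given unmatched x and y, either some matched pair (x′ , y′) can be exchanged for (x , y′) and (x′ , y),
    -- or so few pairs are matched that x has an unmatched partner.
    complete : ∀ Z Xu Yu → All OkPair Z → map proj₁ Z ++ Xu ↭ X → map proj₂ Z ++ Yu ↭ Y → length Xu ≡ length Yu →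
      ∃[ Z′ ] (All OkPair Z′ × map proj₁ Z′ ↭ X × map proj₂ Z′ ↭ Y)
    complete Z [] [] oks pX pY _ = Z , oks ,
      ↭-trans (++-comm [] (map proj₁ Z)) pX , ↭-trans (++-comm [] (map proj₂ Z)) pY
    complete Z (x ∷ Xu) (y ∷ Yu) oks pX pY eq
      with suc (length (filter (λ z → ¬? (ok? x (proj₂ z))) Z) + length (filter (λ z → ¬? (ok? (proj₁ z) y)) Z)) ≤? length Z
    ... | yes few
      with (x′ , y′) , z∈Z , ¬¬xy′ , ¬¬x′y ← ∃-outside (λ z → ¬? (ok? x (proj₂ z))) (λ z → ¬? (ok? (proj₁ z) y)) Z few
      with Z′ , Z↭ ← extract z∈Z
      with _ ∷ oks′ ← All-resp-↭ Z↭ oks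
      = complete ((x , y′) ∷ (x′ , y) ∷ Z′) Xu Yu
          (decidable-stable (ok? x y′) ¬¬xy′ ∷ decidable-stable (ok? x′ y) ¬¬x′y ∷ oks′)
          (↭-trans (↭-trans (prep x (↭-sym (++⁺ʳ Xu (↭-map proj₁ Z↭)))) (↭-sym (shift x (map proj₁ Z) Xu))) pX)
          (↭-trans (↭-trans (swap y′ y ↭-refl) (↭-trans (prep y (↭-sym (++⁺ʳ Yu (↭-map proj₂ Z↭)))) (↭-sym (shift y (map proj₂ Z) Yu)))) pY)
          (suc-injective eq)
    ... | no many
      with y′ , y′∈ , ¬¬xy′ ← unmatched-partner Z pX pY (≮⇒≥ many)
      with Yu′ , Yu↭ ← extract y′∈
      = complete ((x , y′) ∷ Z) Xu Yu′ (decidable-stable (ok? x y′) ¬¬xy′ ∷ oks)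
          (↭-trans (↭-sym (shift x (map proj₁ Z) Xu)) pX)
          (↭-trans (↭-sym (shift y′ (map proj₂ Z) Yu′)) (↭-trans (++⁺ˡ (map proj₂ Z) (↭-sym Yu↭)) pY))
          (suc-injective (≡.trans eq (↭-length Yu↭)))

    pointwise : ∀ Z → All OkPair Z → Pointwise Ok (map proj₁ Z) (map proj₂ Z)
    pointwise [] [] = []
    pointwise (z ∷ Z) (ok ∷ oks) = ok ∷ pointwise Z oks

    perfect-matching : ∃[ X′ ] (X′ ↭ X × Pointwise Ok X′ Y)
    perfect-matching
      with Z , oks , pX , pY ← complete [] X Y [] ↭-refl ↭-refl |X|≡|Y|
      -- The pairs are reordered until their second components form `Y` itself and not just a
      -- permutation of it, because slots have to be served in the order in which they lie on the
      -- paths.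
      with Z′ , eq , Z↭ ← ↭-map-inv proj₂ pY
      = map proj₁ Z′ , ↭-trans (↭-map proj₁ (↭-sym Z↭)) pX ,
        subst (Pointwise Ok (map proj₁ Z′)) (≡.sym eq) (pointwise Z′ (All-resp-↭ Z↭ oks))

  -- Joined graphs

  ∣insert∣ : ∀ {n} (p : Subset n) x → lookup p x ≡ outside → ∣ p [ x ]≔ inside ∣ ≡ suc ∣ p ∣
  ∣insert∣ (outside ∷ p) zero _ = refl
  ∣insert∣ (inside ∷ p) (suc x) eq = cong suc (∣insert∣ p x eq)
  ∣insert∣ (outside ∷ p) (suc x) eq = ∣insert∣ p x eq

  module _ {n : ℕ} where

    open import Data.List.Membership.DecPropositional (Fin._≟_ {n}) public using (_∈?_; _∉?_)

    toSubset : List (Fin n) → Subset n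
    toSubset []       = ∅
    toSubset (x ∷ xs) = toSubset xs [ x ]≔ inside

    ∈-toSubset⁻ : ∀ xs {x} → x ∈ₛ toSubset xs → x ∈ xs
    ∈-toSubset⁻ [] x∈ = contradiction x∈ ∉⊥
    ∈-toSubset⁻ (y ∷ ys) {x} x∈ with x Fin.≟ y
    ... | yes refl = here refl
    ... | no x≢y = there (∈-toSubset⁻ ys (lookup⇒[]= x _
            (≡.trans (≡.sym (lookup∘update′ x≢y (toSubset ys) inside)) ([]=⇒lookup x∈))))

    ∣toSubset∣ : ∀ {xs} → Unique xs → ∣ toSubset xs ∣ ≡ length xs
    ∣toSubset∣ {[]} [] = ∣⊥∣≡0 n
    ∣toSubset∣ {x ∷ xs} u = ≡.trans (∣insert∣ (toSubset xs) x x∉) (cong suc (∣toSubset∣ (unique-tail u)))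
      where
      x∉ : lookup (toSubset xs) x ≡ outside
      x∉ with lookup (toSubset xs) x in eq
      ... | outside = refl
      ... | inside = contradiction (∈-toSubset⁻ xs (lookup⇒[]= x _ eq)) (unique-head u)

    avoid : List (Fin n) → List (Fin n) → List (Fin n)
    avoid U = filter (_∉? U)

    avoid-length : ∀ U {xs} → Unique xs → length xs ≤ length (avoid U xs) + length U
    avoid-length U {xs} u = begin
      length xs                                             ≡⟨ length-filter-∁ (_∈? U) xs ⟨
      length (filter (_∈? U) xs) + length (avoid U xs)      ≤⟨ +-monoˡ-≤ _ (unique-⊆-length (UniqueP.filter⁺ (_∈? U) u) λ i → proj₂ (∈-filter⁻ (_∈? U) {xs = xs} i)) ⟩
      length U + length (avoid U xs)                        ≡⟨ +-comm (length U) _ ⟩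
      length (avoid U xs) + length U                        ∎
      where open ≤-Reasoning

    avoid-⁻ : ∀ U xs {z} → z ∈ avoid U xs → z ∈ xs × z ∉ U
    avoid-⁻ U xs = ∈-filter⁻ (_∉? U) {xs = xs}

  length-allFin : ∀ n → length (allFin n) ≡ n
  length-allFin n = length-tabulate (λ x → x)

  Σ-indicator : ∀ {n} (f : Fin n → Bool) (w : Fin n → ℕ) xs →
    Σ[ xs ] (λ x → (if f x then 1 else 0) * w x) ≡ Σ[ filter (λ x → f x Bool.≟ true) xs ] w
  Σ-indicator f w [] = refl
  Σ-indicator f w (x ∷ xs) with f x
  ... | true = cong₂ _+_ (*-identityˡ (w x)) (Σ-indicator f w xs)
  ... | false = Σ-indicator f w xs

  module GraphLemmas {n : ℕ} (G : Graph n) where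

    V : Set
    V = Fin n

    edge? : ∀ u v → Dec (Edge G u v)
    edge? u v = adj G u v Bool.≟ true

    edge-sym : ∀ {u v} → Edge G u v → Edge G v u
    edge-sym {u} {v} uv = ≡.trans (Graph.sym G v u) uv

    edge-≢ : ∀ {u v} → Edge G u v → u ≢ v
    edge-≢ {u} uu refl with () ← ≡.trans (≡.sym uu) (loopless G u)

    infixl 6 _∩N_
    _∩N_ : List V → V → List V
    xs ∩N v = filter (edge? v) xs

    nbrs : V → List V
    nbrs v = allFin n ∩N v

    ∩N-⁻ : ∀ xs {v z} → z ∈ xs ∩N v → z ∈ xs × Edge G v z
    ∩N-⁻ xs {v} = ∈-filter⁻ (edge? v) {xs = xs}

    ind : V → V → ℕ
    ind u v = if adj G u v then 1 else 0

    length-∩N : ∀ v xs → Σ[ xs ] (ind v) ≡ length (xs ∩N v)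
    length-∩N v xs = ≡.trans (Σ-cong xs (λ x → ≡.sym (*-identityʳ (ind v x)))) (≡.trans (Σ-indicator (adj G v) (λ _ → 1) xs)
      (≡.trans (Σ-const 1 (xs ∩N v)) (*-identityʳ _)))

    unique-nbrs : ∀ v → Unique (nbrs v)
    unique-nbrs v = UniqueP.filter⁺ (edge? v) (UniqueP.allFin⁺ n)

    data Path : V → List V → V → Set where
      single : ∀ x → Path x [ x ] x
      step   : ∀ {x y z L} → Edge G x y → Path y L z → Path x (x ∷ L) z

    path-++ : ∀ {a L b c L′ d} → Path a L b → Edge G b c → Path c L′ d → Path a (L ++ L′) d
    path-++ (single _) bc q = step bc q
    path-++ (step ax p) bc q = step ax (path-++ p bc q)

    path-reverse : ∀ {a L b} → Path a L b → Path b (reverse L) a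
    path-reverse (single x) = single x
    path-reverse (step {x} {L = L} xy p) = subst (λ l → Path _ l x) (≡.sym (unfold-reverse x L))
      (path-++ (path-reverse p) (edge-sym xy) (single x))

    path-walk′ : ∀ {a L b} → Path a L b → Walk G L
    path-walk′ (single x) = tt
    path-walk′ (step xy (single y)) = xy , tt
    path-walk′ (step xy p@(step _ _)) = xy , path-walk′ p

  module JoinedGraph {n : ℕ} (G : Graph n) (m e : ℕ) (joined : Joined G e)
    (1≤n : 1 ≤ n) (mindeg : ∀ v → n ≤ m * degree G v) where

    open GraphLemmas G

    mindeg′ : ∀ v → n ≤ m * length (nbrs v)
    mindeg′ v = subst (λ d → n ≤ m * d) (length-∩N v (allFin n)) (mindeg v)

    -- `Joined` speaks of sets of size exactly `e`, so both lists are truncated before they become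
    -- subsets.
    joined-lists : ∀ {A B} → Unique A → Unique B → (∀ {z} → z ∈ A → z ∉ B) → e ≤ length A → e ≤ length B →
      ∃[ a ] ∃[ b ] (a ∈ A × b ∈ B × Edge G a b)
    joined-lists {A} {B} uA uB d eA eB
      with a , b , a∈ , b∈ , ab ← proj₂ joined (toSubset (take e A)) (toSubset (take e B))
             (λ x xA xB → d (take-⊆ e (∈-toSubset⁻ _ xA)) (take-⊆ e (∈-toSubset⁻ _ xB)))
             (≡.trans (∣toSubset∣ (unique-take e uA)) (length-take-≤ e A eA))
             (≡.trans (∣toSubset∣ (unique-take e uB)) (length-take-≤ e B eB))
      = a , b , take-⊆ e (∈-toSubset⁻ _ a∈) , take-⊆ e (∈-toSubset⁻ _ b∈) , ab

    -- Removing `e` chosen elements of `A` from `B` still leaves `e` elements, hence the factor two.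
    -- Overlaps must be allowed: two neighbourhoods may meet, and vertex insertion looks for an edge
    -- inside a single set.
    joined-overlapping : ∀ {A B} → Unique A → Unique B → e ≤ length A → 2 * e ≤ length B →
      ∃[ a ] ∃[ b ] (a ∈ A × b ∈ B × Edge G a b)
    joined-overlapping {A} {B} uA uB eA eB =
      let a , b , a∈ , b∈ , ab = joined-lists {take e A} {avoid (take e A) B} (unique-take e uA) (UniqueP.filter⁺ (_∉? take e A) uB)
            (λ zA zB → proj₂ (avoid-⁻ (take e A) B zB) zA)
            (≤-reflexive (≡.sym (length-take-≤ e A eA)))
            (linear 0 (+-mono-≤ eB (≤-trans (avoid-length (take e A) uB) (≤-reflexive (cong (length (avoid (take e A) B) +_) (length-take-≤ e A eA)))))
               (lem e (length B) (length (avoid (take e A) B))))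
      in a , b , take-⊆ e a∈ , proj₁ (avoid-⁻ (take e A) B b∈) , ab
      where
      lem : ∀ e b c → e + (b + (c + e)) + 0 ≡ c + (2 * e + b)
      lem = solve-∀

    some-vertex : V
    some-vertex = proj₁ (length-positive {xs = allFin n} (≤-trans 1≤n (≤-reflexive (≡.sym (length-allFin n)))))

    0<m : 0 < m
    0<m = n≢0⇒n>0 λ m≡0 → contradiction (≤-trans 1≤n (subst (λ k → n ≤ k * degree G some-vertex) m≡0 (mindeg some-vertex))) λ ()

    -- A connection of length three. Two vertices may lack a common neighbour, but an edge between
    -- their two large neighbourhoods always exists.
    Link : V → V → (V → Set) → Set
    Link u v Ok = ∃[ l ] ∃[ l′ ] (Ok l × Ok l′ × l ≢ l′ × Edge G u l × Edge G l l′ × Edge G l′ v)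

    link-from : ∀ u v {Ok : V → Set} {A B} → Unique A → Unique B → (∀ {z} → z ∈ A → Ok z × Edge G u z) →
      (∀ {z} → z ∈ B → Ok z × Edge G v z) → 2 * e ≤ length A → 2 * e ≤ length B → Link u v Ok
    link-from u v uA uB okA okB 2e≤A 2e≤B =
      let l , l′ , l∈ , l′∈ , ll′ = joined-overlapping uA uB (≤-trans (m≤m+n e _) 2e≤A) 2e≤B
          okl , ul = okA l∈
          okl′ , vl′ = okB l′∈
      in l , l′ , okl , okl′ , edge-≢ ll′ , ul , ll′ , edge-sym vl′

    link-avoiding : ∀ u v U → m * (length U + 2 * e) ≤ n → Link u v (_∉ U)
    link-avoiding u v U small = link-from u v (UniqueP.filter⁺ (_∉? U) (unique-nbrs u)) (UniqueP.filter⁺ (_∉? U) (unique-nbrs v))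
      (ok u) (ok v) (room-at u) (room-at v)
      where
      ok : ∀ w {z} → z ∈ avoid U (nbrs w) → z ∉ U × Edge G w z
      ok w i = let z∈ , z∉ = avoid-⁻ U (nbrs w) i in z∉ , proj₂ (∩N-⁻ (allFin n) z∈)
      room-at : ∀ w → 2 * e ≤ length (avoid U (nbrs w))
      room-at w = linear 0 (+-mono-≤ (*-cancelˡ-≤ m {{>-nonZero 0<m}} (≤-trans small (mindeg′ w))) (avoid-length U (unique-nbrs w)))
        (lem (2 * e) (length (nbrs w)) (length (avoid U (nbrs w))) (length U))
        where
        lem : ∀ e b c d → e + (b + (c + d)) + 0 ≡ c + (d + e + b)
        lem = solve-∀

    nbrs-outside : ∀ {U} x → 2 * m * length U ≤ n → n ≤ 2 * m * length (avoid U (allFin n) ∩N x)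
    nbrs-outside {U} x small = linear 0 (+-mono-≤ (+-mono-≤ small (+-mono-≤ (mindeg′ x) (mindeg′ x))) (*-monoʳ-≤ (2 * m) deg≤))
        (lem n m (length U) (length (nbrs x)) (length (avoid U (allFin n) ∩N x)))
      where
      deg≤ : length (nbrs x) ≤ length (avoid U (allFin n) ∩N x) + length U
      deg≤ = ≤-trans (avoid-length U (unique-nbrs x)) (+-monoˡ-≤ _ (unique-⊆-length (UniqueP.filter⁺ (_∉? U) (unique-nbrs x))
        (λ z∈ → let z∈N , z∉U = avoid-⁻ U (nbrs x) z∈ ; z∈V , xz = ∩N-⁻ (allFin n) z∈N in ∈-filter⁺ (edge? x) (∈-filter⁺ (_∉? U) z∈V z∉U) xz)))
      lem : ∀ n m u d f → n + (n + (m * d + m * d) + 2 * m * (f + u)) + 0 ≡ 2 * m * f + (2 * m * u + (n + n) + 2 * m * d)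
      lem = solve-∀

    -- Every vertex has at least `n / 2m` neighbours outside `U`, so by double counting an average
    -- vertex outside `U` sees a fraction `1 / 2m` of the weight. The weights are `2 ^ misses` for
    -- the reservoir and constant for the absorbers.
    pick : ∀ (B : List V) (w : V → ℕ) U → 2 * m * length U ≤ n →
      ∃[ a ] (a ∉ U × Σ[ B ] w ≤ 2 * m * Σ[ B ∩N a ] w)
    pick B w U small =
      let a , a∈ , good = exists-≥-average free (λ a → 2 * m * Σ[ B ∩N a ] w) (Σ[ B ] w) 0<|free| average
      in a , proj₂ (avoid-⁻ U (allFin n) a∈) , good
      where
      free = avoid U (allFin n)
      |free|≤n : length free ≤ n
      |free|≤n = ≤-trans (length-filter (_∉? U) (allFin n)) (≤-reflexive (length-allFin n))
      0<|free| : 0 < length free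
      0<|free| with free | nbrs-outside {U} some-vertex small
      ... | []    | h = contradiction (≤-trans 1≤n (≤-trans h (≤-reflexive (*-zeroʳ (2 * m))))) λ ()
      ... | _ ∷ _ | _ = s≤s z≤n
      double-count : Σ[ free ] (λ a → Σ[ B ∩N a ] w) ≡ Σ[ B ] (λ x → w x * length (free ∩N x))
      double-count = begin
        Σ[ free ] (λ a → Σ[ B ∩N a ] w)                ≡⟨ Σ-cong free (λ a → ≡.sym (Σ-indicator (adj G a) w B)) ⟩
        Σ[ free ] (λ a → Σ[ B ] (λ x → ind a x * w x)) ≡⟨ Σ-swap free B (λ a x → ind a x * w x) ⟩
        Σ[ B ] (λ x → Σ[ free ] (λ a → ind a x * w x)) ≡⟨ Σ-cong B (λ x → ≡.trans (Σ-cong free λ a →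
            ≡.trans (*-comm (ind a x) (w x)) (cong (λ b → w x * (if b then 1 else 0)) (Graph.sym G a x))) (Σ-* (w x) free (ind x))) ⟩
        Σ[ B ] (λ x → w x * Σ[ free ] (ind x))         ≡⟨ Σ-cong B (λ x → cong (w x *_) (length-∩N x free)) ⟩
        Σ[ B ] (λ x → w x * length (free ∩N x))        ∎
        where open ≡.≡-Reasoning
      average : length free * Σ[ B ] w ≤ Σ[ free ] (λ a → 2 * m * Σ[ B ∩N a ] w)
      average = begin
        length free * Σ[ B ] w                              ≤⟨ *-monoˡ-≤ (Σ[ B ] w) |free|≤n ⟩
        n * Σ[ B ] w                                     ≡⟨ Σ-* n B w ⟨
        Σ[ B ] (λ x → n * w x)                           ≤⟨ Σ-mono B (λ {x} _ → ≤-trans (*-monoˡ-≤ (w x) (nbrs-outside {U} x small))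
                                                              (≤-reflexive (lem (2 * m) (length (free ∩N x)) (w x)))) ⟩
        Σ[ B ] (λ x → 2 * m * (w x * length (free ∩N x)))   ≡⟨ Σ-* (2 * m) B _ ⟩
        2 * m * Σ[ B ] (λ x → w x * length (free ∩N x))     ≡⟨ cong (2 * m *_) double-count ⟨
        2 * m * Σ[ free ] (λ a → Σ[ B ∩N a ] w)             ≡⟨ Σ-* (2 * m) free _ ⟨
        Σ[ free ] (λ a → 2 * m * Σ[ B ∩N a ] w)             ∎
        where
        open ≤-Reasoning
        lem : ∀ a b c → a * b * c ≡ a * (c * b)
        lem = solve-∀

  -- The reservoir

  module ReservoirLemma {n : ℕ} (G : Graph n) (m e : ℕ) (joined : Joined G e)
    (1≤n : 1 ≤ n) (mindeg : ∀ v → n ≤ m * degree G v) where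
    open GraphLemmas G
    open JoinedGraph G m e joined 1≤n mindeg

    misses : List V → V → ℕ
    misses R v = length (filter (λ r → ¬? (edge? v r)) R)

    -- The potential of a derandomised random choice of R: each greedy step multiplies it by at most 2 - 1/2m,
    -- whereas a vertex with few neighbours in R alone contributes almost 2 ^ length R.
    Ψ : List V → ℕ
    Ψ R = Σ[ allFin n ] (λ v → 2 ^ misses R v)

    Ψ-∷ : ∀ r R → Ψ (r ∷ R) + Σ[ allFin n ∩N r ] (λ v → 2 ^ misses R v) ≡ 2 * Ψ R
    Ψ-∷ r R = begin
      Ψ (r ∷ R) + Σ[ allFin n ∩N r ] w                                     ≡⟨ cong (Ψ (r ∷ R) +_) (Σ-indicator (adj G r) w (allFin n)) ⟨
      Ψ (r ∷ R) + Σ[ allFin n ] (λ v → ind r v * w v)                      ≡⟨ Σ-+ (allFin n) _ _ ⟨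
      Σ[ allFin n ] (λ v → 2 ^ misses (r ∷ R) v + ind r v * w v)           ≡⟨ Σ-cong (allFin n) pointwise ⟩
      Σ[ allFin n ] (λ v → 2 * w v)                                        ≡⟨ Σ-* 2 (allFin n) w ⟩
      2 * Ψ R                                                              ∎
      where
      open ≡.≡-Reasoning
      w = λ v → 2 ^ misses R v
      lem : ∀ x → x + 1 * x ≡ 2 * x
      lem = solve-∀
      pointwise : ∀ v → 2 ^ misses (r ∷ R) v + ind r v * w v ≡ 2 * w v
      pointwise v rewrite Graph.sym G r v with adj G v r
      ... | true  = lem (w v)
      ... | false = +-identityʳ _

    -- Origin of `suc k = 4 * m` for the reservoir: the potential passes from `x` to `y = 2x - h`
    -- with `h ≥ x / 2m`, hence to at most `(4m - 1) / 2m` times `x`.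
    shrinks : ∀ k m x h y → suc k ≡ 4 * m → x ≤ 2 * m * h → y + h ≡ 2 * x → 2 * m * y ≤ k * x
    shrinks k m x h y k≡ x≤ eq = +-cancelʳ-≤ x (2 * m * y) (k * x) (begin
        2 * m * y + x           ≤⟨ +-monoʳ-≤ (2 * m * y) x≤ ⟩
        2 * m * y + 2 * m * h   ≡⟨ lem₃ m y h ⟩
        m * 2 * (y + h)         ≡⟨ cong (m * 2 *_) eq ⟩
        m * 2 * (2 * x)         ≡⟨ lem₄ m x ⟩
        4 * m * x               ≡⟨ cong (_* x) k≡ ⟨
        suc k * x               ≡⟨ +-comm x (k * x) ⟩
        k * x + x               ∎)
      where
      open ≤-Reasoning
      lem₃ : ∀ m y h → 2 * m * y + 2 * m * h ≡ m * 2 * (y + h)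
      lem₃ = solve-∀
      lem₄ : ∀ m x → m * 2 * (2 * x) ≡ 4 * m * x
      lem₄ = solve-∀

    grow : ∀ {B} → Unique B → ∀ k → suc k ≡ 4 * m → ∀ i → 2 * m * (i + length B) ≤ n →
      ∃[ R ] (Unique (R ++ B) × length R ≡ i × (2 * m) ^ i * Ψ R ≤ k ^ i * n)
    grow uB k k≡ zero _ = [] , uB , refl , ≤-reflexive (cong (1 *_) (≡.trans (Σ-const 1 (allFin n))
      (≡.trans (*-identityʳ _) (length-allFin n))))
    grow {B} uB k k≡ (suc i) small =
      let R , uR , |R|≡i , decayed = grow uB k k≡ i (≤-trans (*-monoʳ-≤ (2 * m) (n≤1+n _)) small)
          r , r∉R , heavy = pick (allFin n) (λ v → 2 ^ misses R v) (R ++ B) (≤-trans (*-monoʳ-≤ (2 * m)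
            (≤-trans (≤-reflexive (≡.trans (length-++ R) (cong (_+ length B) |R|≡i))) (n≤1+n _))) small)
      in r ∷ R , unique-cons r∉R uR , cong suc |R|≡i ,
         chain k i (Ψ R) (Ψ (r ∷ R)) n (shrinks k m (Ψ R) (Σ[ allFin n ∩N r ] (λ v → 2 ^ misses R v)) (Ψ (r ∷ R)) k≡ heavy (Ψ-∷ r R)) decayed
      where
      chain : ∀ k i x y n → 2 * m * y ≤ k * x → (2 * m) ^ i * x ≤ k ^ i * n → (2 * m) ^ suc i * y ≤ k ^ suc i * n
      chain k i x y n y≤ x≤ = begin
        2 * m * (2 * m) ^ i * y     ≡⟨ lem₁ (2 * m) ((2 * m) ^ i) y ⟩
        (2 * m) ^ i * (2 * m * y)   ≤⟨ *-monoʳ-≤ ((2 * m) ^ i) y≤ ⟩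
        (2 * m) ^ i * (k * x)       ≡⟨ lem₂ ((2 * m) ^ i) k x ⟩
        k * ((2 * m) ^ i * x)       ≤⟨ *-monoʳ-≤ k x≤ ⟩
        k * (k ^ i * n)             ≡⟨ *-assoc k (k ^ i) n ⟨
        k * k ^ i * n               ∎
        where
        open ≤-Reasoning
        lem₁ : ∀ a b c → a * b * c ≡ b * (a * c)
        lem₁ = solve-∀
        lem₂ : ∀ a b c → a * (b * c) ≡ b * (a * c)
        lem₂ = solve-∀

    -- For a vertex with `h` neighbours among the `i` chosen vertices, the single term `2 ^ x` of
    -- the potential is at most `(k / 2m) ^ i * n`. Multiplying by `2 ^ h` and using `suc k = 4 * m`
    -- gives `(1 + 1/k) ^ i ≤ n * 2 ^ h`. For `i = suc k * (2 * g)` the left side is at least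
    -- `2 ^ (2 * g)`, so `n < 2 ^ g` rules out `h < g`.
    many-hits : ∀ k g h x → suc k ≡ 4 * m → 3 ≤ k → n < 2 ^ g → x + h ≡ suc k * (2 * g) →
      (2 * m) ^ (suc k * (2 * g)) * 2 ^ x ≤ k ^ (suc k * (2 * g)) * n → g ≤ h
    many-hits k g h x k≡ 3≤k n<2^g x+h≡ hyp with g ≤? h
    ... | yes g≤h = g≤h
    ... | no g≰h = contradiction 2^2g≤ (<⇒≱ (begin-strict
        n * 2 ^ h          <⟨ *-monoˡ-< (2 ^ h) {{>-nonZero (m^n>0 2 h)}} n<2^g ⟩
        2 ^ g * 2 ^ h      ≤⟨ *-monoʳ-≤ (2 ^ g) (^-monoʳ-≤ 2 (<⇒≤ (≰⇒> g≰h))) ⟩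
        2 ^ g * 2 ^ g      ≡⟨ ^-distribˡ-+-* 2 g g ⟨
        2 ^ (g + g)        ≡⟨ cong (λ z → 2 ^ (g + z)) (+-identityʳ g) ⟨
        2 ^ (2 * g)        ≡⟨ *-identityʳ _ ⟨
        2 ^ (2 * g) * 1    ∎))
      where
      open ≤-Reasoning
      i = suc k * (2 * g)
      lem : ∀ a b c → a * b * c ≡ c * a * b
      lem = solve-∀
      2^2g≤ : 2 ^ (2 * g) * 1 ≤ n * 2 ^ h
      2^2g≤ = decay k (2 * g) {1} {n * 2 ^ h} (≤-trans (s≤s z≤n) 3≤k) (begin
        suc k ^ i * 1                     ≡⟨ *-identityʳ _ ⟩
        suc k ^ i                         ≡⟨ cong (_^ i) (≡.trans k≡ (*-assoc 2 2 m)) ⟩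
        (2 * (2 * m)) ^ i                 ≡⟨ ^-distribʳ i 2 (2 * m) ⟩
        2 ^ i * (2 * m) ^ i               ≡⟨ cong (λ z → 2 ^ z * (2 * m) ^ i) x+h≡ ⟨
        2 ^ (x + h) * (2 * m) ^ i         ≡⟨ cong (_* (2 * m) ^ i) (^-distribˡ-+-* 2 x h) ⟩
        2 ^ x * 2 ^ h * (2 * m) ^ i       ≡⟨ lem (2 ^ x) (2 ^ h) ((2 * m) ^ i) ⟩
        (2 * m) ^ i * 2 ^ x * 2 ^ h       ≤⟨ *-monoˡ-≤ (2 ^ h) hyp ⟩
        k ^ i * n * 2 ^ h                 ≡⟨ *-assoc (k ^ i) n _ ⟩
        k ^ i * (n * 2 ^ h)               ∎)

    reservoir′ : ∀ {B} → Unique B → ∀ k g → suc k ≡ 4 * m → 3 ≤ k → 2 * m * (suc k * (2 * g) + length B) ≤ n → n < 2 ^ g →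
      ∃[ R ] (Unique (R ++ B) × length R ≡ suc k * (2 * g) × (∀ v → g ≤ length (R ∩N v)))
    reservoir′ uB k g k≡ 3≤k small n<2^g =
      let R , uR , |R|≡ , decayed = grow uB k k≡ (suc k * (2 * g)) small in
      R , uR , |R|≡ , λ v → many-hits k g (length (R ∩N v)) (misses R v) k≡ 3≤k n<2^g
        (≡.trans (+-comm (misses R v) _) (≡.trans (length-filter-∁ (edge? v) R) |R|≡))
        (≤-trans (*-monoʳ-≤ ((2 * m) ^ (suc k * (2 * g))) (∈-Σ-≤ (λ v → 2 ^ misses R v) (∈-allFin v))) decayed)

    reservoir : ∀ {B} → Unique B → ∀ g → 2 * m * (4 * m * (2 * g) + length B) ≤ n → n < 2 ^ g →
      ∃[ R ] (Unique (R ++ B) × length R ≡ 4 * m * (2 * g) × (∀ v → g ≤ length (R ∩N v)))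
    reservoir {B} uB g small n<2^g =
      subst (λ i → ∃[ R ] (Unique (R ++ B) × length R ≡ i * (2 * g) × (∀ v → g ≤ length (R ∩N v)))) k≡
        (reservoir′ uB (pred (4 * m)) g k≡ (≤-pred (≤-trans (*-monoʳ-≤ 4 0<m) (≤-reflexive (≡.sym k≡))))
          (subst (λ i → 2 * m * (i * (2 * g) + length B) ≤ n) (≡.sym k≡) small) n<2^g)
      where
      k≡ : suc (pred (4 * m)) ≡ 4 * m
      k≡ = suc-pred (4 * m) {{>-nonZero (≤-trans (s≤s z≤n) (*-monoʳ-≤ 4 0<m))}}

  -- Blocks and slots

  filter-filter : ∀ {a p q} {A : Set a} {P : A → Set p} {Q : A → Set q} (P? : ∀ x → Dec (P x)) (Q? : ∀ x → Dec (Q x)) xs →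
    filter Q? (filter P? xs) ≡ filter (λ x → P? x ×-dec Q? x) xs
  filter-filter P? Q? [] = refl
  filter-filter P? Q? (x ∷ xs) with P? x
  ... | no _ = filter-filter P? Q? xs
  ... | yes _ with Q? x
  ...   | no _ = filter-filter P? Q? xs
  ...   | yes _ = cong (x ∷_) (filter-filter P? Q? xs)

  module Absorbers {n : ℕ} (G : Graph n) where
    open GraphLemmas G

    -- The list of new vertices may be empty, and is then no `Path`. Describing it by its effect on
    -- a path ending in `u` covers this case and turns concatenation into composition.
    Extends : V → List V → V → Set
    Extends u L z = ∀ {s K} → Path s K u → Path s (K ++ L) z

    extends-[] : ∀ {u} → Extends u [] u
    extends-[] {u} {s} {K} p = subst (λ l → Path s l u) (≡.sym (++-identityʳ K)) p

    extends-++ : ∀ {u L v L′ w} → Extends u L v → Extends v L′ w → Extends u (L ++ L′) w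
    extends-++ {L = L} {L′ = L′} f g {s} {K} p = subst (λ l → Path s l _) (++-assoc K L L′) (g (f p))

    extends-path : ∀ {u v L w} → Edge G u v → Path v L w → Extends u L w
    extends-path uv q p = path-++ p uv q

    -- A block is the path l l′ a p c c′ b q; as p ~ q, a common neighbour x of a and b is absorbed
    -- by the path l l′ a x b c′ c p q with the same ends.
    record Block : Set where
      field
        {l l′ a p c c′ b q} : V
        ll′ : Edge G l l′
        l′a : Edge G l′ a
        ap  : Edge G a p
        pc  : Edge G p c
        cc′ : Edge G c c′
        c′b : Edge G c′ b
        bq  : Edge G b q
        pq  : Edge G p q

    open Block

    vertices : Block → List V
    vertices B = l B ∷ l′ B ∷ a B ∷ p B ∷ c B ∷ c′ B ∷ b B ∷ q B ∷ []

    block-path : ∀ B → Path (l B) (vertices B) (q B)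
    block-path B = step (ll′ B) (step (l′a B) (step (ap B) (step (pc B) (step (cc′ B) (step (c′b B) (step (bq B) (single (q B))))))))

    Absorbs : Block → V → Set
    Absorbs B x = Edge G (a B) x × Edge G (b B) x

    absorbs? : ∀ B x → Dec (Absorbs B x)
    absorbs? B x = edge? (a B) x ×-dec edge? (b B) x

    absorbed : Block → V → List V
    absorbed B x = l B ∷ l′ B ∷ a B ∷ x ∷ b B ∷ c′ B ∷ c B ∷ p B ∷ q B ∷ []

    absorbed-path : ∀ B {x} → Absorbs B x → Path (l B) (absorbed B x) (q B)
    absorbed-path B (ax , bx) = step (ll′ B) (step (l′a B) (step ax (step (edge-sym bx) (step (edge-sym (c′b B))
      (step (edge-sym (cc′ B)) (step (edge-sym (pc B)) (step (pq B) (single (q B)))))))))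

    absorbed-↭ : ∀ B x → absorbed B x ↭ x ∷ vertices B
    absorbed-↭ B x = ↭-trans (shift x (l B ∷ l′ B ∷ a B ∷ []) (reverse (p B ∷ c B ∷ c′ B ∷ b B ∷ []) ++ [ q B ]))
      (prep x (++⁺ˡ (l B ∷ l′ B ∷ a B ∷ []) (++⁺ʳ [ q B ] (↭-reverse (p B ∷ c B ∷ c′ B ∷ b B ∷ [])))))

    data Chained {X : Set} (R : V → X → V → Set) : V → List X → V → Set where
      []  : ∀ {u} → Chained R u [] u
      _∷_ : ∀ {u x v xs w} → R u x v → Chained R v xs w → Chained R u (x ∷ xs) w

    Slot : Set
    Slot = List Block

    BlockFrom : V → Block → V → Set
    BlockFrom u B v = Edge G u (l B) × q B ≡ v

    SlotFrom : V → Slot → V → Set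
    SlotFrom = Chained BlockFrom

    RowFrom : V → List Slot → V → Set
    RowFrom = Chained SlotFrom

    slotVertices : Slot → List V
    slotVertices = concatMap vertices

    rowVertices : List Slot → List V
    rowVertices = concatMap slotVertices

    length-slotVertices : ∀ s → length (slotVertices s) ≡ 8 * length s
    length-slotVertices [] = refl
    length-slotVertices (B ∷ s) = ≡.trans (cong (8 +_) (length-slotVertices s)) (≡.sym (*-suc 8 (length s)))

    SlotAbsorbs : V → Slot → Set
    SlotAbsorbs x s = Any (λ B → Absorbs B x) s

    slotAbsorbs? : ∀ x s → Dec (SlotAbsorbs x s)
    slotAbsorbs? x s = any? (λ B → absorbs? B x) s

    extends-block : ∀ {u B v} → BlockFrom u B v → Extends u (vertices B) v
    extends-block {B = B} (e , refl) = extends-path e (block-path B)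

    extends-slot : ∀ {u s v} → SlotFrom u s v → Extends u (slotVertices s) v
    extends-slot [] = extends-[]
    extends-slot (_∷_ {x = B} e bs) = extends-++ {L = vertices B} (extends-block {B = B} e) (extends-slot bs)

    -- Only the one block singled out by the `Any` proof is rerouted and the others keep their
    -- paths, so a slot always grows by exactly one vertex and keeps its ends.
    absorb-slot : ∀ {x u s v} → SlotFrom u s v → SlotAbsorbs x s → ∃[ L ] (Extends u L v × L ↭ x ∷ slotVertices s)
    absorb-slot {x} (_∷_ {x = B} {xs = s} (e , refl) bs) (here ab) =
      absorbed B x ++ slotVertices s , extends-++ {L = absorbed B x} (extends-path e (absorbed-path B ab)) (extends-slot bs) ,
      ++⁺ʳ (slotVertices s) (absorbed-↭ B x)
    absorb-slot {x} (_∷_ {x = B} {xs = s} e bs) (there abs) =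
      let L , ext , L↭ = absorb-slot bs abs in
      vertices B ++ L , extends-++ {L = vertices B} (extends-block {B = B} e) ext ,
      ↭-trans (++⁺ˡ (vertices B) L↭) (shift x (vertices B) (slotVertices s))

    absorb-row : ∀ {X u S v} → RowFrom u S v → Pointwise SlotAbsorbs X S → ∃[ L ] (Extends u L v × L ↭ X ++ rowVertices S)
    absorb-row [] [] = [] , extends-[] , ↭-refl
    absorb-row {x ∷ X} {S = s ∷ S} (sl ∷ row) (ab ∷ abs) =
      let L₁ , ext₁ , L₁↭ = absorb-slot sl ab
          L₂ , ext₂ , L₂↭ = absorb-row row abs
      in L₁ ++ L₂ , extends-++ {L = L₁} ext₁ ext₂ , ↭-trans (++⁺ L₁↭ L₂↭) (prep x (shifts (slotVertices s) X))

    missed : Slot → List V → List V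
    missed s = filter (λ x → ¬? (slotAbsorbs? x s))

    -- This is what allows an adaptive choice of blocks: the next one is picked with respect to the
    -- vertices still missed, so that the missed proportions multiply.
    missed-∷ : ∀ B s xs → missed (B ∷ s) xs ≡ missed s (filter (λ x → ¬? (absorbs? B x)) xs)
    missed-∷ B s xs = ≡.trans
      (filter-≐ _ (λ x → ¬? (absorbs? B x) ×-dec ¬? (slotAbsorbs? x s))
        ((λ ¬any → (λ ab → ¬any (here ab)) , (λ abs → ¬any (there abs))) ,
         (λ { (¬ab , _) (here ab) → ¬ab ab ; (_ , ¬abs) (there abs) → ¬abs abs })) xs)
      (≡.sym (filter-filter (λ x → ¬? (absorbs? B x)) (λ x → ¬? (slotAbsorbs? x s)) xs))

  module BuildSlots {n : ℕ} (G : Graph n) (m e : ℕ) (joined : Joined G e)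
    (1≤n : 1 ≤ n) (mindeg : ∀ v → n ≤ m * degree G v)
    (K : ℕ) (roomy : 2 * m * (K + 2 * e) ≤ n)
    (k : ℕ) (k≡ : suc k ≡ 4 * m * m) where
    open GraphLemmas G
    open JoinedGraph G m e joined 1≤n mindeg
    open Absorbers G
    open Block

    roomy-pick : ∀ {u} → u ≤ K → 2 * m * u ≤ n
    roomy-pick u≤K = ≤-trans (*-monoʳ-≤ (2 * m) (≤-trans u≤K (m≤m+n K _))) roomy

    roomy-link : ∀ {u} → u ≤ K → m * (u + 2 * e) ≤ n
    roomy-link u≤K = ≤-trans (*-mono-≤ (m≤m+n m _) (+-monoˡ-≤ (2 * e) u≤K)) roomy

    -- Origin of `suc k = 4 * m * m` for the slots: `a` sees a fraction `1 / 2m` of `X`, and `b` a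
    -- fraction `1 / 2m` of that, so the block misses at most `1 - 1 / 4m²` of `X`.
    pair-decay : ∀ X X₁ X₂ X′ → X ≤ 2 * m * X₁ → X₁ ≤ 2 * m * X₂ → X₂ + X′ ≡ X → suc k * X′ ≤ k * X
    pair-decay X X₁ X₂ X′ h₁ h₂ eq = +-cancelʳ-≤ X (suc k * X′) (k * X) (begin
      suc k * X′ + X                           ≤⟨ +-monoʳ-≤ (suc k * X′) (≤-trans h₁ (*-monoʳ-≤ (2 * m) h₂)) ⟩
      suc k * X′ + 2 * m * (2 * m * X₂)        ≡⟨ cong (λ z → z * X′ + 2 * m * (2 * m * X₂)) k≡ ⟩
      4 * m * m * X′ + 2 * m * (2 * m * X₂)    ≡⟨ lem m X′ X₂ ⟩
      4 * m * m * (X₂ + X′)                    ≡⟨ cong₂ _*_ (≡.sym k≡) eq ⟩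
      suc k * X                                ≡⟨ +-comm X (k * X) ⟩
      k * X + X                                ∎)
      where
      open ≤-Reasoning
      lem : ∀ m x y → 4 * m * m * x + 2 * m * (2 * m * y) ≡ 4 * m * m * (y + x)
      lem = solve-∀

    -- The pair `a`, `b` is fixed first, for its many common neighbours in `X`; everything else
    -- consists of links. A link `a p q b` supplies the edge `pq`, used only after absorption, when
    -- `ap` and `bq` are dropped. A second link `p c c′ b` joins `p` to `b` in both states, and a
    -- third one leads from the current end to `a`.
    build-block : ∀ u U X → Unique U → 8 + length U ≤ K →
      ∃[ B ] (BlockFrom u B (q B) × Unique (vertices B ++ U) ×
              suc k * length (filter (λ x → ¬? (absorbs? B x)) X) ≤ k * length X)
    build-block u U X uU small =
      let a , a∉ , heavy₁ = pick X (λ _ → 1) U (roomy-pick (≤-trans (m≤n+m _ 8) small))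
          b , b∉ , heavy₂ = pick (X ∩N a) (λ _ → 1) (a ∷ U) (roomy-pick (≤-trans (m≤n+m _ 7) small))
          p , q , p∉ , q∉ , p≢q , ap , pq , qb = link-avoiding a b (b ∷ a ∷ U) (roomy-link (≤-trans (m≤n+m _ 6) small))
          c , c′ , c∉ , c′∉ , c≢c′ , pc , cc′ , c′b = link-avoiding p b (q ∷ p ∷ b ∷ a ∷ U) (roomy-link (≤-trans (m≤n+m _ 4) small))
          l , l′ , l∉ , l′∉ , l≢l′ , ul , ll′ , l′a = link-avoiding u a (c′ ∷ c ∷ q ∷ p ∷ b ∷ a ∷ U) (roomy-link (≤-trans (m≤n+m _ 2) small))
          B = record { ll′ = ll′ ; l′a = l′a ; ap = ap ; pc = pc ; cc′ = cc′ ; c′b = c′b ; bq = edge-sym qb ; pq = pq }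
      in B , (ul , refl) ,
         covering-unique
           (unique-cons (λ { (here eq) → l≢l′ eq ; (there i) → l∉ i }) (unique-cons l′∉
           (unique-cons (λ { (here eq) → c≢c′ (≡.sym eq) ; (there i) → c′∉ i }) (unique-cons c∉
           (unique-cons (λ { (here eq) → p≢q (≡.sym eq) ; (there i) → q∉ i }) (unique-cons p∉ (unique-cons b∉ (unique-cons a∉ uU))))))))
           rearrange ≤-refl ,
         pair-decay (length X) (length (X ∩N a)) (length (X ∩N a ∩N b)) _ (unweigh X (X ∩N a) heavy₁) (unweigh (X ∩N a) (X ∩N a ∩N b) heavy₂)
           (≡.trans (cong (λ z → length z + length (filter (λ x → ¬? (absorbs? B x)) X)) (filter-filter (edge? a) (edge? b) X))
             (length-filter-∁ (absorbs? B) X))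
      where
      rearrange : ∀ {l l′ c c′ p q b a z} → z ∈ l ∷ l′ ∷ c′ ∷ c ∷ q ∷ p ∷ b ∷ a ∷ U → z ∈ l ∷ l′ ∷ a ∷ p ∷ c ∷ c′ ∷ b ∷ q ∷ U
      rearrange (here eq) = here eq
      rearrange (there (here eq)) = there (here eq)
      rearrange (there (there (here eq))) = there (there (there (there (there (here eq)))))
      rearrange (there (there (there (here eq)))) = there (there (there (there (here eq))))
      rearrange (there (there (there (there (here eq))))) = there (there (there (there (there (there (there (here eq)))))))
      rearrange (there (there (there (there (there (here eq)))))) = there (there (there (here eq)))
      rearrange (there (there (there (there (there (there (here eq))))))) = there (there (there (there (there (there (here eq))))))
      rearrange (there (there (there (there (there (there (there (here eq)))))))) = there (there (here eq))
      rearrange (there (there (there (there (there (there (there (there i)))))))) = there (there (there (there (there (there (there (there i)))))))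
      unweigh : ∀ X Y → Σ[ X ] (λ _ → 1) ≤ 2 * m * Σ[ Y ] (λ _ → 1) → length X ≤ 2 * m * length Y
      unweigh X Y h = subst (λ z → length X ≤ 2 * m * z) (≡.trans (Σ-const 1 Y) (*-identityʳ _))
        (≤-trans (≤-reflexive (≡.sym (≡.trans (Σ-const 1 X) (*-identityʳ _)))) h)

    build-blocks : ∀ i u U X → Unique U → 8 * i + length U ≤ K →
      ∃[ s ] ∃[ v ] (SlotFrom u s v × length s ≡ i × Unique (slotVertices s ++ U) ×
                     suc k ^ i * length (missed s X) ≤ k ^ i * length X)
    build-blocks zero u U X uU small = [] , u , [] , refl , uU , *-monoʳ-≤ 1 (length-filter _ X)
    build-blocks (suc i) u U X uU small =
      let B , from , uB , decayed = build-block u U X uU (≤-trans (+-monoˡ-≤ (length U) (≤-trans (m≤m+n 8 (8 * i)) (≤-reflexive (≡.sym (*-suc 8 i))))) small)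
          X′ = filter (λ x → ¬? (absorbs? B x)) X
          s , v , chain , |s|≡ , us , decayed′ = build-blocks i (q B) (vertices B ++ U) X′ uB
            (≤-trans (≤-reflexive (≡.trans (≡.sym (+-assoc (8 * i) 8 (length U))) (cong (_+ length U) (≡.trans (+-comm (8 * i) 8) (≡.sym (*-suc 8 i)))))) small)
      in B ∷ s , v , from ∷ chain , cong suc |s|≡ ,
         unique-resp (↭-trans (shifts (slotVertices s) (vertices B)) (↭-reflexive (≡.sym (++-assoc (vertices B) (slotVertices s) U)))) us ,
         compound (suc k) k i (length (missed (B ∷ s) X)) (length X′) (length X)
           (subst (λ z → suc k ^ i * z ≤ k ^ i * length X′) (cong length (≡.sym (missed-∷ B s X))) decayed′) decayed
      where
      compound : ∀ h k i x y z → h ^ i * x ≤ k ^ i * y → h * y ≤ k * z → h ^ suc i * x ≤ k ^ suc i * z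
      compound h k i x y z p q = begin
        h * h ^ i * x     ≡⟨ *-assoc h (h ^ i) x ⟩
        h * (h ^ i * x)   ≤⟨ *-monoʳ-≤ h p ⟩
        h * (k ^ i * y)   ≡⟨ lem h (k ^ i) y ⟩
        k ^ i * (h * y)   ≤⟨ *-monoʳ-≤ (k ^ i) q ⟩
        k ^ i * (k * z)   ≡⟨ lem₂ (k ^ i) k z ⟩
        k * k ^ i * z     ∎
        where
        open ≤-Reasoning
        lem : ∀ a b c → a * (b * c) ≡ b * (a * c)
        lem = solve-∀
        lem₂ : ∀ a b c → a * (b * c) ≡ b * a * c
        lem₂ = solve-∀

  -- Path surgery and Hamilton paths

  module PathSurgery {n : ℕ} (G : Graph n) where
    open GraphLemmas G

    succsFrom : V → V → List V → List V
    succsFrom x u []      = []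
    succsFrom x u (v ∷ L) with edge? x u
    ... | yes _ = v ∷ succsFrom x v L
    ... | no _  = succsFrom x v L

    -- the vertices of the list whose predecessor in it is adjacent to x
    succs : V → List V → List V
    succs x []      = []
    succs x (u ∷ L) = succsFrom x u L

    succs-⊆ : ∀ x u L {z} → z ∈ succs x (u ∷ L) → z ∈ L
    succs-⊆ x u (v ∷ L) z∈ with edge? x u
    succs-⊆ x u (v ∷ L) (here eq)  | yes _ = here eq
    succs-⊆ x u (v ∷ L) (there z∈) | yes _ = there (succs-⊆ x v L z∈)
    succs-⊆ x u (v ∷ L) z∈         | no _  = there (succs-⊆ x v L z∈)

    succs-⊆′ : ∀ x L {z} → z ∈ succs x L → z ∈ L
    succs-⊆′ x (u ∷ L) z∈ = there (succs-⊆ x u L z∈)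

    unique-succs : ∀ x {L} → Unique L → Unique (succs x L)
    unique-succs x {[]} _ = []
    unique-succs x {_ ∷ []} _ = []
    unique-succs x {u ∷ L@(v ∷ L′)} (_ ∷ uL) with edge? x u
    ... | yes _ = unique-cons (λ v∈ → unique-head uL (succs-⊆ x v L′ v∈)) (unique-succs x uL)
    ... | no _ = unique-succs x uL

    length-succsFrom : ∀ x u L → length ((u ∷ L) ∩N x) ≤ suc (length (succsFrom x u L))
    length-succsFrom x u [] = length-filter (edge? x) [ u ]
    length-succsFrom x u (v ∷ L) with edge? x u
    ... | yes _ = s≤s (length-succsFrom x v L)
    ... | no _ = length-succsFrom x v L

    -- Only the last vertex of the list has no successor, so at most one neighbour is lost.
    length-succs : ∀ x L → length (L ∩N x) ≤ suc (length (succs x L))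
    length-succs x [] = z≤n
    length-succs x (u ∷ L) = length-succsFrom x u L

    -- Cutting in front of `t` destroys only the consecutive pair that ends in `t`, whence the
    -- exclusion of `t`.
    succsFrom-++ : ∀ x u A {t M z} → z ∈ succsFrom x u (A ++ t ∷ M) → z ≢ t → z ∈ succsFrom x u A ⊎ z ∈ succsFrom x t M
    succsFrom-++ x u [] z∈ z≢t with edge? x u
    succsFrom-++ x u [] (here eq)  z≢t | yes _ = contradiction eq z≢t
    succsFrom-++ x u [] (there z∈) z≢t | yes _ = inj₂ z∈
    succsFrom-++ x u [] z∈         z≢t | no _  = inj₂ z∈
    succsFrom-++ x u (v ∷ A) z∈ z≢t with edge? x u
    succsFrom-++ x u (v ∷ A) (here eq)  z≢t | yes _ = inj₁ (here eq)
    succsFrom-++ x u (v ∷ A) (there z∈) z≢t | yes _ with succsFrom-++ x v A z∈ z≢t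
    ... | inj₁ i = inj₁ (there i)
    ... | inj₂ i = inj₂ i
    succsFrom-++ x u (v ∷ A) z∈ z≢t | no _ = succsFrom-++ x v A z∈ z≢t

    succs-++ : ∀ x A {t M z} → z ∈ succs x (A ++ t ∷ M) → z ≢ t → z ∈ succs x A ⊎ z ∈ succs x (t ∷ M)
    succs-++ x [] z∈ _ = inj₂ z∈
    succs-++ x (u ∷ A) z∈ z≢t = succsFrom-++ x u A z∈ z≢t

    record Cut (a : V) (P : List V) (t z : V) : Set where
      constructor cut
      field
        {L₁ L₂} : List V
        {u} : V
        eq : P ≡ L₁ ++ t ∷ L₂
        before : Path a L₁ u
        after : Path t (t ∷ L₂) z

    cut-from : ∀ x u {v L z t} → Edge G u v → Path v L z → t ∈ succsFrom x u L →
      Σ (Cut u (u ∷ L) t z) λ c → Edge G x (Cut.u c)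
    cut-from x u uv (single v) t∈ with edge? x u
    cut-from x u uv (single v) (here refl) | yes xu = cut refl (single u) (single v) , xu
    cut-from x u uv (step {x = v} vw p) t∈ with edge? x u
    cut-from x u uv (step {x = v} vw p) (here refl) | yes xu = cut refl (single u) (step vw p) , xu
    cut-from x u uv (step {x = v} vw p) (there t∈) | yes _ with cut-from x v vw p t∈
    ... | cut eq bef aft , xw = cut (cong (u ∷_) eq) (step uv bef) aft , xw
    cut-from x u uv (step {x = v} vw p) t∈ | no _ with cut-from x v vw p t∈
    ... | cut eq bef aft , xw = cut (cong (u ∷_) eq) (step uv bef) aft , xw

    cut-at : ∀ x {a P z t} → Path a P z → t ∈ succs x P → Σ (Cut a P t z) λ c → Edge G x (Cut.u c)
    cut-at x (step {x = u} uv p) t∈ = cut-from x u uv p t∈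

    -- Reversing the middle piece M makes room for x between its old ends.
    insert : ∀ {a A w s M u t R z x} → Path a A w → Path s M u → Path t R z →
      Edge G x w → Edge G x u → Edge G s t → ∃[ P ] (Path a P z × P ↭ x ∷ (A ++ M ++ R))
    insert {A = A} {M = M} {R = R} {x = x} pA pM pR xw xu st =
      A ++ x ∷ (reverse M ++ R) ,
      path-++ pA (edge-sym xw) (step xu (path-++ (path-reverse pM) st pR)) ,
      ↭-trans (shift x A (reverse M ++ R)) (prep x (++⁺ˡ A (++⁺ʳ R (↭-reverse M))))

    -- Cutting in front of `s` and of `t` leaves three pieces, the first two ending in neighbours of
    -- `x`. The cases decide only whether the middle piece starts at `s` or at `t`; these differ,
    -- being the ends of an edge.
    insert-at : ∀ x {a P z s t} → Path a P z → s ∈ succs x P → t ∈ succs x P → Edge G s t →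
      ∃[ P′ ] (Path a P′ z × P′ ↭ x ∷ P)
    insert-at x {s = s} {t} p s∈ t∈ st with cut-at x p s∈
    ... | cut {A} {M} refl bef aft , xu with succs-++ x A t∈ (λ t≡s → edge-≢ st (≡.sym t≡s))
    ...   | inj₁ t∈A with cut-at x bef t∈A
    ...     | cut {A₁} {A₂} refl bef₁ aft₁ , xw =
      let P′ , p′ , P′↭ = insert bef₁ aft₁ aft xw xu (edge-sym st)
      in P′ , p′ , ↭-trans P′↭ (↭-reflexive (cong (x ∷_) (≡.sym (++-assoc A₁ (t ∷ A₂) (s ∷ M)))))
    insert-at x {s = s} {t} p s∈ t∈ st | cut {A} refl bef aft , xu | inj₂ t∈M with cut-at x aft t∈M
    ...     | cut {A₁} {A₂} eq bef₁ aft₁ , xw =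
      let P′ , p′ , P′↭ = insert bef bef₁ aft₁ xu xw st
      in P′ , p′ , ↭-trans P′↭ (↭-reflexive (cong (λ l → x ∷ (A ++ l)) (≡.sym eq)))

    -- Pósa's rotation: the part of the path behind a neighbour of the end `z` is reversed, which
    -- makes the successor of that neighbour the new end.
    rotate : ∀ {a P z t} → Path a P z → t ∈ succs z P → ∃[ P′ ] (Path a P′ t × P′ ↭ P)
    rotate {z = z} p t∈ with cut-at z p t∈
    ... | cut {A} {M} refl bef aft , zu = A ++ reverse (_ ∷ M) , path-++ bef (edge-sym zu) (path-reverse aft) , ++⁺ˡ A (↭-reverse (_ ∷ M))

    record Piece (s : ℕ) : Set where
      field
        {first last} : V
        {body} : List V
        path : Path first body last
        lower : s ≤ length body
        upper : length body ≤ suc s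

    path-take : ∀ s {a L b} → Path a L b → suc s < length L →
      ∃[ A ] ∃[ M ] ∃[ u ] ∃[ t ] (L ≡ A ++ M × length A ≡ suc s × Path a A u × Path t M b)
    path-take zero (step {x} {y} {L = L} _ p) _ = [ x ] , L , x , y , refl , refl , single x , p
    path-take (suc s) (step {x} xy p) (s≤s l) =
      let A , M , u , t , eq , |A| , pA , pM = path-take s p l in
      x ∷ A , M , u , t , cong (x ∷_) eq , cong suc |A| , step xy pA , pM
    path-take s (single _) (s≤s ())

    pieceVertices : ∀ {E : Set} {s} {es : List E} → All (λ _ → Piece s) es → List V
    pieceVertices [] = []
    pieceVertices (q ∷ qs) = Piece.body q ++ pieceVertices qs

    -- The remainder `r` is spent one vertex at a time on the leading pieces. The size `suc d` keeps
    -- all pieces nonempty, so that each has two ends to link.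
    cut-pieces : ∀ {E : Set} (e : E) (es : List E) d r {a L b} → Path a L b →
      length L ≡ suc (length es) * suc d + r → r ≤ suc (length es) →
      Σ (All (λ _ → Piece (suc d)) (e ∷ es)) λ qs → pieceVertices qs ≡ L
    cut-pieces e [] d r {L = L} p eq r≤ = record { path = p ; lower = ≤-trans (m≤m+n (suc d) (0 + r)) (≤-reflexive (≡.sym eq′)) ;
        upper = ≤-trans (≤-reflexive eq′) (≤-trans (+-monoʳ-≤ (suc d) r≤) (≤-reflexive (+-comm (suc d) 1))) } ∷ [] , ++-identityʳ L
      where
      eq′ : length L ≡ suc d + r
      eq′ = ≡.trans eq (cong (_+ r) (*-identityˡ (suc d)))
    cut-pieces e (e′ ∷ es) d zero p eq r≤ =
      let A , M , u , t , L≡ , |A| , pA , pM = path-take d p (≤-trans (m≤m+n (suc (suc d)) _) (≤-reflexive (≡.sym (≡.trans eq (lem d (length es))))))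
          qs , qs≡ = cut-pieces e′ es d zero pM (+-cancelˡ-≡ (suc d) _ _ (≡.trans (cong (_+ length M) (≡.sym |A|))
                       (≡.trans (≡.sym (length-++ A)) (≡.trans (≡.sym (cong length L≡)) (≡.trans eq (+-assoc (suc d) (suc (length es) * suc d) 0)))))) z≤n
      in record { path = pA ; lower = ≤-reflexive (≡.sym |A|) ; upper = ≤-trans (≤-reflexive |A|) (n≤1+n _) } ∷ qs ,
         ≡.trans (cong (A ++_) qs≡) (≡.sym L≡)
      where
      lem : ∀ d k → suc (suc k) * suc d + 0 ≡ suc (suc d) + (d + k * suc d)
      lem = solve-∀
    cut-pieces e (e′ ∷ es) d (suc r) p eq (s≤s r≤) =
      let A , M , u , t , L≡ , |A| , pA , pM = path-take (suc d) p (≤-trans (m≤m+n (suc (suc (suc d))) _) (≤-reflexive (≡.sym (≡.trans eq (lem d (length es) r)))))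
          qs , qs≡ = cut-pieces e′ es d r pM (+-cancelˡ-≡ (suc (suc d)) _ _ (≡.trans (cong (_+ length M) (≡.sym |A|))
                       (≡.trans (≡.sym (length-++ A)) (≡.trans (≡.sym (cong length L≡)) (≡.trans eq (lem₂ (suc d) (suc (length es) * suc d) r)))))) r≤
      in record { path = pA ; lower = ≤-trans (n≤1+n _) (≤-reflexive (≡.sym |A|)) ; upper = ≤-reflexive |A| } ∷ qs ,
         ≡.trans (cong (A ++_) qs≡) (≡.sym L≡)
      where
      lem : ∀ d k r → suc (suc k) * suc d + suc r ≡ suc (suc (suc d)) + (d + k * suc d + r)
      lem = solve-∀
      lem₂ : ∀ d k r → d + k + suc r ≡ suc d + (k + r)
      lem₂ = solve-∀

  module Hamiltonian {n : ℕ} (G : Graph n) (m e : ℕ) (joined : Joined G e)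
    (1≤n : 1 ≤ n) (mindeg : ∀ v → n ≤ m * degree G v)
    (W : List (Fin n)) (uW : Unique W)
    (dense : ∀ v → 3 * e + 1 ≤ length (GraphLemmas._∩N_ G W v)) where
    open GraphLemmas G
    open JoinedGraph G m e joined 1≤n mindeg
    open PathSurgery G

    -- The bound `3 * e + 1` is made for the insertion step: up to `e` neighbours may lie off the
    -- path, one may be its last vertex and have no successor, and `2 * e` successors are needed to
    -- find an edge with both ends among them.
    split-degree : ∀ P O v → P ++ O ↭ W → 3 * e + 1 ≤ length (P ∩N v) + length (O ∩N v)
    split-degree P O v P++O = ≤-trans (dense v) (≤-reflexive (≡.trans (↭-length (filter-↭ (edge? v) (↭-sym P++O)))
      (length-filter-++ (edge? v) P O)))

    unique-P : ∀ P {O} → P ++ O ↭ W → Unique P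
    unique-P P P++O = unique-++⁻ˡ P (unique-resp (↭-sym P++O) uW)

    append : ∀ {a P z y O} → Path a P z → Edge G z y → y ∈ O → P ++ O ↭ W →
      ∃[ P′ ] ∃[ O′ ] ∃[ z′ ] (Path a P′ z′ × P′ ++ O′ ↭ W × length O ≡ suc (length O′))
    append {P = P} {y = y} p zy y∈O P++O =
      let O′ , O↭ = extract y∈O in
      P ++ [ y ] , O′ , y , path-++ p zy (single y) ,
      ↭-trans (↭-reflexive (++-assoc P [ y ] O′)) (↭-trans (++⁺ˡ P (↭-sym O↭)) P++O) , ↭-length O↭

    -- If the end z has no neighbour outside the path, then either there are enough outside vertices
    -- to find one adjacent to the end of some rotation, or so few that any of them can be inserted.
    lengthen : ∀ {a P z} x O → Path a P z → P ++ x ∷ O ↭ W →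
      ∃[ P′ ] ∃[ O′ ] ∃[ z′ ] (Path a P′ z′ × P′ ++ O′ ↭ W × length (x ∷ O) ≡ suc (length O′))
    lengthen {a} {P} {z} x O p P++O with any? (edge? z) (x ∷ O)
    ... | yes zO = let y , y∈ , zy = find zO in append p zy y∈ P++O
    ... | no ¬zO with e ≤? length (x ∷ O)
    ...   | yes e≤ =
      let t , y , t∈ , y∈ , ty = joined-lists {succs z P} {x ∷ O} (unique-succs z (unique-P P P++O))
            (unique-++⁻ʳ P (unique-resp (↭-sym P++O) uW))
            (λ i j → unique-disjoint P (unique-resp (↭-sym P++O) uW) (succs-⊆′ z P i) j)
            (arith₁ e (length (P ∩N z)) _ (≤-trans (split-degree P (x ∷ O) z P++O)
              (≤-reflexive (≡.trans (cong (λ l → length (P ∩N z) + length l) (filter-none (edge? z) (AllP.¬Any⇒All¬ (x ∷ O) ¬zO))) (+-identityʳ _)))) (length-succs z P)) e≤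
          P′ , p′ , P′↭ = rotate p t∈
      in append p′ ty y∈ (↭-trans (++⁺ʳ (x ∷ O) P′↭) P++O)
      where
      arith₁ : ∀ e d s → 3 * e + 1 ≤ d → d ≤ suc s → e ≤ s
      arith₁ e d s h₁ h₂ = linear (2 * e) (+-mono-≤ h₁ h₂) (lem e d s)
        where
        lem : ∀ e d s → e + (d + suc s) + 2 * e ≡ s + (3 * e + 1 + d)
        lem = solve-∀
    ...   | no e≰ =
      let s , t , s∈ , t∈ , st = joined-overlapping {succs x P} {succs x P} (unique-succs x (unique-P P P++O)) (unique-succs x (unique-P P P++O))
            (≤-trans (m≤m+n e _) 2e≤) 2e≤
          P′ , p′ , P′↭ = insert-at x p s∈ t∈ st
      in P′ , O , z , p′ , ↭-trans (++⁺ʳ O P′↭) (↭-trans (↭-sym (shift x P O)) P++O) , refl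
      where
      arith₂ : ∀ e d o s → 3 * e + 1 ≤ d + o → o ≤ e → d ≤ suc s → 2 * e ≤ s
      arith₂ e d o s h₁ h₂ h₃ = linear 0 (+-mono-≤ h₁ (+-mono-≤ h₂ h₃)) (lem e d o s)
        where
        lem : ∀ e d o s → 2 * e + (d + o + (e + suc s)) + 0 ≡ s + (3 * e + 1 + (o + d))
        lem = solve-∀
      2e≤ : 2 * e ≤ length (succs x P)
      2e≤ = arith₂ e (length (P ∩N x)) (length ((x ∷ O) ∩N x)) _ (split-degree P (x ∷ O) x P++O)
        (≤-trans (length-filter (edge? x) (x ∷ O)) (<⇒≤ (≰⇒> e≰))) (length-succs x P)

    exhaust : ∀ k {a P z} O → length O ≡ k → Path a P z → P ++ O ↭ W → ∃[ P′ ] ∃[ z′ ] (Path a P′ z′ × P′ ↭ W)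
    exhaust zero {P = P} [] _ p P++O = P , _ , p , ↭-trans (↭-reflexive (≡.sym (++-identityʳ P))) P++O
    exhaust (suc k) (x ∷ O) eq p P++O =
      let P′ , O′ , z′ , p′ , P′++O′ , shorter = lengthen x O p P++O in
      exhaust k O′ (suc-injective (≡.trans (≡.sym shorter) eq)) p′ P′++O′

    hamilton-path : 1 ≤ length W → ∃[ a ] ∃[ P ] ∃[ z ] (Path a P z × P ↭ W)
    hamilton-path 1≤W =
      let w , w∈ = length-positive 1≤W
          W′ , W↭ = extract w∈
          P , z , p , P↭ = exhaust (length W′) W′ refl (single w) (↭-sym W↭)
      in w , P , z , p , P↭

  -- Assembling the paths

  length-filter-Σ : ∀ {P : A → Set ℓ₃} (P? : ∀ x → Dec (P x)) xs →
    length (filter P? xs) ≡ Σ[ xs ] (λ x → if Dec.does (P? x) then 1 else 0)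
  length-filter-Σ P? [] = refl
  length-filter-Σ P? (x ∷ xs) with Dec.does (P? x)
  ... | true  = cong suc (length-filter-Σ P? xs)
  ... | false = length-filter-Σ P? xs

  double-counting : ∀ {P : A → B → Set ℓ₃} (P? : ∀ x y → Dec (P x y)) xs ys →
    Σ[ xs ] (λ x → length (filter (P? x) ys)) ≡ Σ[ ys ] (λ y → length (filter (λ x → P? x y) xs))
  double-counting P? xs ys = ≡.trans (Σ-cong xs (λ x → length-filter-Σ (P? x) ys))
    (≡.trans (Σ-swap xs ys _) (Σ-cong ys (λ y → ≡.sym (length-filter-Σ (λ x → P? x y) xs))))

  Σ-filter-≤ : ∀ {P : A → Set ℓ₃} (P? : ∀ x → Dec (P x)) xs (f : A → ℕ) → Σ[ filter P? xs ] f ≤ Σ[ xs ] f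
  Σ-filter-≤ P? [] f = z≤n
  Σ-filter-≤ P? (x ∷ xs) f with Dec.does (P? x)
  ... | true  = +-monoʳ-≤ (f x) (Σ-filter-≤ P? xs f)
  ... | false = ≤-trans (Σ-filter-≤ P? xs f) (m≤n+m _ (f x))

  pointwise-split : ∀ {R : A → B → Set ℓ₃} {xs} ys {zs} → Pointwise R xs (ys ++ zs) →
    ∃[ xs₁ ] ∃[ xs₂ ] (xs ≡ xs₁ ++ xs₂ × Pointwise R xs₁ ys × Pointwise R xs₂ zs)
  pointwise-split [] rs = [] , _ , refl , [] , rs
  pointwise-split (y ∷ ys) (r ∷ rs) = let xs₁ , xs₂ , eq , rs₁ , rs₂ = pointwise-split ys rs
    in _ , xs₂ , cong (_ ∷_) eq , r ∷ rs₁ , rs₂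

  pointwise-length : ∀ {R : A → B → Set ℓ₃} {xs ys} → Pointwise R xs ys → length xs ≡ length ys
  pointwise-length [] = refl
  pointwise-length (_ ∷ rs) = cong suc (pointwise-length rs)

  Σ-const-≤ : ∀ (xs : List A) {f : A → ℕ} {c} → (∀ {x} → x ∈ xs → f x ≤ c) → Σ[ xs ] f ≤ length xs * c
  Σ-const-≤ xs {c = c} h = ≤-trans (Σ-mono xs h) (≤-reflexive (Σ-const c xs))

  length-filter-mono : ∀ {P : A → Set ℓ₃} (P? : ∀ x → Dec (P x)) {xs ys : List A} → Unique xs → (∀ {z} → z ∈ xs → z ∈ ys) →
    length (filter P? xs) ≤ length (filter P? ys)
  length-filter-mono P? {xs} {ys} u s = unique-⊆-length (UniqueP.filter⁺ P? u)
    (λ i → let i′ , pz = ∈-filter⁻ P? {xs = xs} i in ∈-filter⁺ P? (s i′) pz)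

  divide : ∀ w k → suc k ≤ w → ∃[ d ] ∃[ r ] (w ≡ suc k * suc d + r × r ≤ suc k)
  divide w k k<w = pred (w / suc k) , w % suc k , (begin
    w                                                ≡⟨ m≡m%n+[m/n]*n w (suc k) ⟩
    w % suc k + w / suc k * suc k                    ≡⟨ +-comm (w % suc k) _ ⟩
    w / suc k * suc k + w % suc k                    ≡⟨ cong (_+ w % suc k) (*-comm (w / suc k) (suc k)) ⟩
    suc k * (w / suc k) + w % suc k                  ≡⟨ cong (λ z → suc k * z + w % suc k) (suc-pred (w / suc k) {{>-nonZero (m≥n⇒m/n>0 k<w)}}) ⟨
    suc k * suc (pred (w / suc k)) + w % suc k       ∎) , <⇒≤ (m%n<n w (suc k))
    where open ≡.≡-Reasoning

  unique-⊆-↭ : ∀ {xs ys : List A} → Unique xs → (∀ {z} → z ∈ xs → z ∈ ys) → length ys ≤ length xs → xs ↭ ys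
  unique-⊆-↭ {xs = []} {[]} u s l = ↭-refl
  unique-⊆-↭ {xs = x ∷ xs} u s l =
    let ys′ , ys↭ = extract (s (here refl)) in
    ↭-trans (prep x (unique-⊆-↭ (unique-tail u) (λ i → ∈-tail (∈-resp-↭ ys↭ (s (there i))) (λ { refl → unique-head u i }))
      (≤-pred (≤-trans (≤-reflexive (↭-length (↭-sym ys↭))) l)))) (↭-sym ys↭)

  module Branchings {n : ℕ} (G : Graph n) {t : ℕ} (branches : Fin t → Fin n) where
    open GraphLemmas G

    E : Set
    E = Fin t × Fin t

    bs : List V
    bs = map branches (allFin t)

    record Branching (lo : ℕ) (ij : E) : Set where
      field
        inner : List V
        path : Path (branches (proj₁ ij)) (branches (proj₁ ij) ∷ inner ++ [ branches (proj₂ ij) ]) (branches (proj₂ ij))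
        lower : lo ≤ length inner
        upper : length inner ≤ suc lo

    innerVertices : ∀ {lo ks} → All (Branching lo) ks → List V
    innerVertices [] = []
    innerVertices (β ∷ βs) = Branching.inner β ++ innerVertices βs

  module Assembly {n : ℕ} (G : Graph n) (m e : ℕ) (joined : Joined G e)
    (1≤n : 1 ≤ n) (mindeg : ∀ v → n ≤ m * degree G v)
    {t : ℕ} (branches : Fin t → Fin n) (e₀ : Fin t × Fin t) (es₀ : List (Fin t × Fin t))
    (uB : Unique (map branches (allFin t)))
    (K : ℕ) (roomy : 2 * m * (K + 2 * e) ≤ n)
    (k J M q g : ℕ) (k≡ : suc k ≡ 4 * m * m) (M≡ : M ≡ suc k * J) (J-large : 128 * m ≤ 2 ^ J)
    (n<2^g : n < 2 ^ g) (1≤q : 1 ≤ q)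
    (budget : t + 4 * m * (2 * g) + suc (length es₀) * q * (8 * M) ≤ K)
    (fits : 4 * (suc (length es₀) * (q + 4)) + g ≤ 4 * (4 * m * (2 * g)))
    (tight : 4 * m * (2 * g) + 4 * suc (length es₀) + 2 * e ≤ g + suc (length es₀) * (q + 4))
    where
    open GraphLemmas G
    open JoinedGraph G m e joined 1≤n mindeg
    open ReservoirLemma G m e joined 1≤n mindeg
    open Absorbers G
    open BuildSlots G m e joined 1≤n mindeg K roomy k k≡
    open PathSurgery G
    open Branchings G branches

    es : List E
    es = e₀ ∷ es₀

    N : ℕ
    N = length es

    r₀ : ℕ
    r₀ = 4 * m * (2 * g)

    1≤k : 1 ≤ k
    1≤k = ≤-pred (≤-trans (s≤s (s≤s z≤n)) (≤-trans (*-mono-≤ (*-monoʳ-≤ 4 0<m) 0<m) (≤-reflexive (≡.sym k≡))))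

    record Row (ij : E) : Set where
      field
        slots : List Slot
        {exit} : V
        chain : RowFrom (branches (proj₁ ij)) slots exit
        count : length slots ≡ q
        rowSize : length (rowVertices slots) ≡ q * (8 * M)

    open Row

    allSlots : ∀ {ks} → All Row ks → List Slot
    allSlots [] = []
    allSlots (ρ ∷ ρs) = slots ρ ++ allSlots ρs

    GoodSlot : List V → Slot → Set
    GoodSlot X s = 2 ^ J * length (missed s X) ≤ length X

    -- Unlike the shrinking set inside a slot, `X` stays the same for all slots: each slot on its
    -- own has to accept almost every reservoir vertex, as it is open which one it will receive.
    build-row : ∀ i u U X → Unique U → i * (8 * M) + length U ≤ K →
      ∃[ S ] ∃[ v ] (RowFrom u S v × length S ≡ i × length (rowVertices S) ≡ i * (8 * M) ×
                     Unique (rowVertices S ++ U) × All (GoodSlot X) S)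
    build-row zero u U X uU small = [] , u , [] , refl , refl , uU , []
    build-row (suc i) u U X uU small =
      let s , v , chain , |s|≡ , us , decayed = build-blocks M u U X uU (≤-trans (+-monoˡ-≤ (length U) (m≤m+n (8 * M) (i * (8 * M)))) small)
          |sV|≡ = ≡.trans (length-slotVertices s) (cong (8 *_) |s|≡)
          S , w , row , |S|≡ , |SV|≡ , uS , goods = build-row i v (slotVertices s ++ U) X us
            (≤-trans (≤-reflexive (≡.trans (cong (i * (8 * M) +_) (≡.trans (length-++ (slotVertices s)) (cong (_+ length U) |sV|≡)))
               (lem (i * (8 * M)) (8 * M) (length U)))) small)
      in s ∷ S , w , chain ∷ row , cong suc |S|≡ , ≡.trans (length-++ (slotVertices s)) (cong₂ _+_ |sV|≡ |SV|≡) ,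
         unique-resp (↭-trans (shifts (rowVertices S) (slotVertices s)) (↭-reflexive (≡.sym (++-assoc (slotVertices s) (rowVertices S) U)))) uS ,
         decay k J 1≤k (subst (λ z → suc k ^ z * length (missed s X) ≤ k ^ z * length X) M≡ decayed) ∷ goods
      where
      lem : ∀ a b c → a + (b + c) ≡ b + a + c
      lem = solve-∀

    build-rows : ∀ ks U X → Unique U → length ks * q * (8 * M) + length U ≤ K →
      Σ (All Row ks) λ ρs → length (allSlots ρs) ≡ length ks * q × length (rowVertices (allSlots ρs)) ≡ length ks * q * (8 * M) ×
        Unique (rowVertices (allSlots ρs) ++ U) × All (GoodSlot X) (allSlots ρs)
    build-rows [] U X uU small = [] , refl , refl , uU , []
    build-rows ((i , j) ∷ ks) U X uU small =
      let S , v , row , |S|≡ , |SV|≡ , uS , goods = build-row q (branches i) U X uU (≤-trans (+-monoˡ-≤ (length U) (*-monoˡ-≤ (8 * M) (m≤m+n q (length ks * q)))) small)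
          ρs , |ρ|≡ , |ρV|≡ , uρ , goodsρ = build-rows ks (rowVertices S ++ U) X uS
            (≤-trans (≤-reflexive (≡.trans (cong (length ks * q * (8 * M) +_) (≡.trans (length-++ (rowVertices S)) (cong (_+ length U) |SV|≡)))
               (lem (length ks * q) q (8 * M) (length U)))) small)
          split = concatMap-++ slotVertices S (allSlots ρs)
      in record { slots = S ; chain = row ; count = |S|≡ ; rowSize = |SV|≡ } ∷ ρs ,
         ≡.trans (length-++ S) (cong₂ _+_ |S|≡ |ρ|≡) ,
         ≡.trans (cong length split) (≡.trans (length-++ (rowVertices S)) (≡.trans (cong₂ _+_ |SV|≡ |ρV|≡) (≡.sym (*-distribʳ-+ (8 * M) q (length ks * q))))) ,
         unique-resp (↭-trans (shifts (rowVertices (allSlots ρs)) (rowVertices S)) (↭-reflexive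
           (≡.trans (≡.sym (++-assoc (rowVertices S) (rowVertices (allSlots ρs)) U)) (cong (_++ U) (≡.sym split))))) uρ ,
         AllP.++⁺ goods goodsρ
      where
      lem : ∀ a q M u → a * M + (q * M + u) ≡ (q + a) * M + u
      lem = solve-∀

    -- The size counts, for each of the `N` pairs, one vertex per slot and four link vertices, so
    -- that after linking exactly as many vertices remain as there are slots. In `rich`, `4 * N`
    -- allows for the vertices already used by links and `2 * e` for making the next one.
    record Reserved (S : List Slot) (R₀ : List V) : Set where
      field
        R : List V
        unique : Unique R
        ⊆R₀ : ∀ {v} → v ∈ R → v ∈ R₀
        size : length R ≡ N * (q + 4)
        few-misses : ∀ {x} → x ∈ R → 4 * length (filter (λ s → ¬? (slotAbsorbs? x s)) S) ≤ length S
        rich : ∀ v → 4 * N + 2 * e ≤ length (R ∩N v)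

    module _ (S : List Slot) (R₀ : List V) where

      good? : ∀ x → Dec (4 * length (filter (λ s → ¬? (slotAbsorbs? x s)) S) ≤ length S)
      good? x = _ ≤? length S

      goods bads : List V
      goods = filter good? R₀
      bads = filter (λ x → ¬? (good? x)) R₀

      -- Double counting: a bad vertex is missed by more than a quarter of the slots, while a slot
      -- misses at most `r₀ / 2 ^ J` vertices, so at most `4 * r₀ / 2 ^ J` vertices are bad. As
      -- `r₀ = 8 * m * g`, this is at most `g / 4` when `2 ^ J ≥ 128 * m`, which explains that
      -- constant.
      few-bads : length R₀ ≡ r₀ → 1 ≤ length S → All (GoodSlot R₀) S → 4 * length bads ≤ g
      few-bads |R₀| 1≤S goodS = bound (*-cancelʳ-≤ (2 ^ J * length bads) (4 * length R₀) (length S) {{>-nonZero 1≤S}} (begin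
        2 ^ J * length bads * length S                           ≡⟨ *-assoc (2 ^ J) _ _ ⟩
        2 ^ J * (length bads * length S)                         ≡⟨ cong (2 ^ J *_) (Σ-const (length S) bads) ⟨
        2 ^ J * Σ[ bads ] (λ _ → length S)                       ≤⟨ *-monoʳ-≤ (2 ^ J) (Σ-mono bads (λ {x} i → <⇒≤ (≰⇒> (proj₂ (∈-filter⁻ (λ x → ¬? (good? x)) {xs = R₀} i))))) ⟩
        2 ^ J * Σ[ bads ] (λ x → 4 * miss x)                     ≤⟨ *-monoʳ-≤ (2 ^ J) (Σ-filter-≤ (λ x → ¬? (good? x)) R₀ (λ x → 4 * miss x)) ⟩
        2 ^ J * Σ[ R₀ ] (λ x → 4 * miss x)                       ≡⟨ cong (2 ^ J *_) (≡.trans (Σ-* 4 R₀ miss) (cong (4 *_) (double-counting (λ x s → ¬? (slotAbsorbs? x s)) R₀ S))) ⟩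
        2 ^ J * (4 * Σ[ S ] (λ s → length (missed s R₀)))        ≡⟨ lem (2 ^ J) (Σ[ S ] (λ s → length (missed s R₀))) ⟩
        4 * (2 ^ J * Σ[ S ] (λ s → length (missed s R₀)))        ≡⟨ cong (4 *_) (Σ-* (2 ^ J) S _) ⟨
        4 * Σ[ S ] (λ s → 2 ^ J * length (missed s R₀))          ≤⟨ *-monoʳ-≤ 4 (Σ-const-≤ S (All.lookup goodS)) ⟩
        4 * (length S * length R₀)                               ≡⟨ lem₂ (length S) (length R₀) ⟩
        4 * length R₀ * length S                                 ∎))
        where
        open ≤-Reasoning
        miss = λ x → length (filter (λ s → ¬? (slotAbsorbs? x s)) S)
        lem : ∀ a b → a * (4 * b) ≡ 4 * (a * b)
        lem = solve-∀
        lem₂ : ∀ a b → 4 * (a * b) ≡ 4 * b * a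
        lem₂ = solve-∀
        lem₃ : ∀ m b → 32 * m * (4 * b) ≡ 128 * m * b
        lem₃ = solve-∀
        lem₄ : ∀ m g → 4 * (4 * m * (2 * g)) ≡ 32 * m * g
        lem₄ = solve-∀
        bound : 2 ^ J * length bads ≤ 4 * length R₀ → 4 * length bads ≤ g
        bound h = *-cancelˡ-≤ (32 * m) {{>-nonZero (≤-trans (s≤s z≤n) (*-monoʳ-≤ 32 0<m))}} (begin
          32 * m * (4 * length bads)   ≡⟨ lem₃ m (length bads) ⟩
          128 * m * length bads        ≤⟨ *-monoˡ-≤ (length bads) J-large ⟩
          2 ^ J * length bads          ≤⟨ h ⟩
          4 * length R₀                ≡⟨ cong (4 *_) |R₀| ⟩
          4 * r₀                       ≡⟨ lem₄ m g ⟩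
          32 * m * g                   ∎)

      -- At most `g / 4` vertices are bad, and `fits` leaves enough good ones for the exact size. No
      -- vertex loses more neighbours than there are discarded vertices, and `tight` keeps their
      -- number at most `g - 4N - 2e`.
      reserve : Unique R₀ → length R₀ ≡ r₀ → (∀ v → g ≤ length (R₀ ∩N v)) → 1 ≤ length S → All (GoodSlot R₀) S → Reserved S R₀
      reserve uR₀ |R₀| rich₀ 1≤S goodS = record
        { R = R ; unique = unique-take s (UniqueP.filter⁺ good? uR₀)
        ; ⊆R₀ = λ i → proj₁ (∈-filter⁻ good? {xs = R₀} (take-⊆ s i))
        ; size = |R|≡ ; few-misses = λ i → proj₂ (∈-filter⁻ good? {xs = R₀} (take-⊆ s i))
        ; rich = λ v → arith₂ r₀ N e g s (length (R ∩N v)) (length rest) tight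
            (≡.trans (cong (_+ length rest) (≡.sym |R|≡)) (≡.trans (≡.sym (length-++ R)) (≡.trans (↭-length R++rest) |R₀|)))
            (≤-trans (rich₀ v) (≤-trans (≤-reflexive (≡.trans (↭-length (filter-↭ (edge? v) (↭-sym R++rest))) (length-filter-++ (edge? v) R rest)))
              (+-monoʳ-≤ (length (R ∩N v)) (length-filter (edge? v) rest)))) }
        where
        s = N * (q + 4)
        R = take s goods
        rest = drop s goods ++ bads
        R++rest : R ++ rest ↭ R₀
        R++rest = ↭-trans (↭-reflexive (≡.trans (≡.sym (++-assoc R (drop s goods) bads)) (cong (_++ bads) (take++drop≡id s goods)))) (filter-∁-↭ good? R₀)
        arith₁ : ∀ s g b x r → 4 * s + g ≤ 4 * r → 4 * b ≤ g → x + b ≡ r → 4 * s ≤ 4 * x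
        arith₁ s g b x r h₁ h₂ refl = linear 0 (+-mono-≤ h₁ h₂) (lem s g b x)
          where
          lem : ∀ s g b x → 4 * s + (4 * (x + b) + g) + 0 ≡ 4 * x + (4 * s + g + 4 * b)
          lem = solve-∀
        arith₂ : ∀ r N e g s h x → r + 4 * N + 2 * e ≤ g + s → s + x ≡ r → g ≤ h + x → 4 * N + 2 * e ≤ h
        arith₂ r N e g s h x h₁ refl h₂ = linear 0 (+-mono-≤ h₁ h₂) (lem N e g s h x)
          where
          lem : ∀ N e g s h x → 4 * N + 2 * e + (g + s + (h + x)) + 0 ≡ h + (s + x + 4 * N + 2 * e + g)
          lem = solve-∀
        |R|≡ : length R ≡ s
        |R|≡ = length-take-≤ s goods (*-cancelˡ-≤ 4 (arith₁ s g (length bads) (length goods) r₀ fits (few-bads |R₀| 1≤S goodS)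
          (≡.trans (length-filter-∁ good? R₀) |R₀|)))

    data Links (Ok : V → Set) {s} : ∀ {ks} → All Row ks → All (λ _ → Piece s) ks → Set where
      []  : Links Ok [] []
      _∷_ : ∀ {ij ks} {ρ : Row ij} {π : Piece s} {ρs : All Row ks} {πs} →
            Link (exit ρ) (Piece.first π) Ok × Link (Piece.last π) (branches (proj₂ ij)) Ok →
            Links Ok ρs πs → Links Ok (ρ ∷ ρs) (π ∷ πs)

    linkVertices : ∀ {Ok s ks} {ρs : All Row ks} {πs : All (λ _ → Piece s) ks} → Links Ok ρs πs → List V
    linkVertices [] = []
    linkVertices (((l₁ , l₂ , _) , (l₃ , l₄ , _)) ∷ Λ) = l₁ ∷ l₂ ∷ l₃ ∷ l₄ ∷ linkVertices Λ

    links-ok : ∀ {Ok s ks} {ρs : All Row ks} {πs : All (λ _ → Piece s) ks} (Λ : Links Ok ρs πs) {z} → z ∈ linkVertices Λ → Ok z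
    links-ok (((_ , _ , ok , _) , _) ∷ Λ) (here refl) = ok
    links-ok (((_ , _ , _ , ok , _) , _) ∷ Λ) (there (here refl)) = ok
    links-ok ((_ , (_ , _ , ok , _)) ∷ Λ) (there (there (here refl))) = ok
    links-ok ((_ , (_ , _ , _ , ok , _)) ∷ Λ) (there (there (there (here refl)))) = ok
    links-ok (_ ∷ Λ) (there (there (there (there i)))) = links-ok Λ i

    relax : ∀ {Ok Ok′ : V → Set} {u v} → (∀ {z} → Ok z → Ok′ z) → Link u v Ok → Link u v Ok′
    relax f (l , l′ , ok , ok′ , rest) = l , l′ , f ok , f ok′ , rest

    module _ {S : List Slot} {R₀ : List V} (ℛ : Reserved S R₀) where
      open Reserved ℛ

      link-inside : ∀ u v Us → length Us ≤ 4 * N → Link u v (λ z → z ∈ R × z ∉ Us)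
      link-inside u v Us few = link-from u v (uA u) (uA v) (ok u) (ok v) (enough u) (enough v)
        where
        uN : ∀ w → Unique (R ∩N w)
        uN w = UniqueP.filter⁺ (edge? w) unique
        uA : ∀ w → Unique (avoid Us (R ∩N w))
        uA w = UniqueP.filter⁺ (_∉? Us) (uN w)
        ok : ∀ w {z} → z ∈ avoid Us (R ∩N w) → (z ∈ R × z ∉ Us) × Edge G w z
        ok w i = let j , z∉ = avoid-⁻ Us (R ∩N w) i ; z∈R , e = ∩N-⁻ R j in (z∈R , z∉) , e
        enough : ∀ w → 2 * e ≤ length (avoid Us (R ∩N w))
        enough w = linear 0 (+-mono-≤ (rich w) (+-mono-≤ (avoid-length Us (uN w)) few))
          (lem (2 * e) (4 * N) (length (R ∩N w)) (length (avoid Us (R ∩N w))) (length Us))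
          where
          lem : ∀ e N r a u → e + (r + (a + u + N)) + 0 ≡ a + (N + e + (r + u))
          lem = solve-∀

      build-links : ∀ {s ks} (ρs : All Row ks) (πs : All (λ _ → Piece s) ks) Us → Unique Us → length Us + 4 * length ks ≤ 4 * N →
        Σ (Links (_∈ R) ρs πs) λ Λ → Unique (linkVertices Λ ++ Us) × length (linkVertices Λ) ≡ 4 * length ks
      build-links [] [] Us uUs few = [] , uUs , refl
      build-links {ks = (i , j) ∷ ks} (ρ ∷ ρs) (π ∷ πs) Us uUs few =
        let link₁@(l₁ , l₂ , (_ , l₁∉) , (_ , l₂∉) , l₁≢l₂ , _) = link-inside (exit ρ) (Piece.first π) Us (few₀ (length Us) (length ks) few)
            link₂@(l₃ , l₄ , (_ , l₃∉) , (_ , l₄∉) , l₃≢l₄ , _) = link-inside (Piece.last π) (branches j) (l₁ ∷ l₂ ∷ Us) (few₂ (length Us) (length ks) few)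
            Λ , uΛ , |Λ| = build-links ρs πs (l₃ ∷ l₄ ∷ l₁ ∷ l₂ ∷ Us)
              (unique-cons (λ { (here eq) → l₃≢l₄ eq ; (there k) → l₃∉ k }) (unique-cons l₄∉
              (unique-cons (λ { (here eq) → l₁≢l₂ eq ; (there k) → l₁∉ k }) (unique-cons l₂∉ uUs)))) (≤-trans (≤-reflexive (lem (length Us) (length ks))) few)
        in (relax proj₁ link₁ , relax proj₁ link₂) ∷ Λ ,
           unique-resp (↭-trans (shifts (linkVertices Λ) (l₃ ∷ l₄ ∷ l₁ ∷ l₂ ∷ [])) (shifts (l₃ ∷ l₄ ∷ []) (l₁ ∷ l₂ ∷ []))) uΛ ,
           ≡.trans (cong (4 +_) |Λ|) (≡.sym (*-suc 4 (length ks)))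
        where
        lem : ∀ u k → suc (suc (suc (suc u))) + 4 * k ≡ u + 4 * suc k
        lem = solve-∀
        few₀ : ∀ u k → u + 4 * suc k ≤ 4 * N → u ≤ 4 * N
        few₀ u k h = ≤-trans (m≤m+n u _) h
        few₂ : ∀ u k → u + 4 * suc k ≤ 4 * N → suc (suc u) ≤ 4 * N
        few₂ u k h = ≤-trans (≤-trans (m≤m+n (suc (suc u)) (2 + 4 * k)) (≤-reflexive (lem₂ u k))) h
          where
          lem₂ : ∀ u k → suc (suc u) + (2 + 4 * k) ≡ u + 4 * suc k
          lem₂ = solve-∀

    -- The summands are the absorbed vertices, the `q` slots of `M` blocks with eight vertices each,
    -- the two links, and the least size of a piece of the Hamilton path.
    lengthOf : ℕ → ℕ
    lengthOf d = q + q * (8 * M) + 4 + d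

    module _ where
      open import Algebra.Solver.CommutativeMonoid (++-commutativeMonoid {A = V})

      regroup : ∀ (L X₁ S₁ l₁ body l₂ rest X₂ S₂ P₂ Λ₂ : List V) → L ↭ X₁ ++ S₁ → rest ↭ X₂ ++ (S₂ ++ (P₂ ++ Λ₂)) →
        (L ++ (l₁ ++ (body ++ l₂))) ++ rest ↭ (X₁ ++ X₂) ++ ((S₁ ++ S₂) ++ ((body ++ P₂) ++ (l₁ ++ (l₂ ++ Λ₂))))
      regroup L X₁ S₁ l₁ body l₂ rest X₂ S₂ P₂ Λ₂ L↭ rest↭ = ↭-trans (++⁺ (++⁺ʳ (l₁ ++ (body ++ l₂)) L↭) rest↭)
        (solve 9 (λ x₁ s₁ l₁ b l₂ x₂ s₂ p₂ λ₂ →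
          ((x₁ ⊕ s₁) ⊕ (l₁ ⊕ (b ⊕ l₂))) ⊕ (x₂ ⊕ (s₂ ⊕ (p₂ ⊕ λ₂))) ⊜ (x₁ ⊕ x₂) ⊕ ((s₁ ⊕ s₂) ⊕ ((b ⊕ p₂) ⊕ (l₁ ⊕ (l₂ ⊕ λ₂)))))
          ↭-refl X₁ S₁ l₁ body l₂ X₂ S₂ P₂ Λ₂)

      rearrange : ∀ (b x s p l : List V) → b ++ (x ++ (s ++ (p ++ l))) ↭ (b ++ (s ++ (x ++ l))) ++ p
      rearrange = solve 5 (λ b x s p l → b ⊕ (x ⊕ (s ⊕ (p ⊕ l))) ⊜ (b ⊕ (s ⊕ (x ⊕ l))) ⊕ p) ↭-refl

    assemble : ∀ {Ok d ks} (ρs : All Row ks) (πs : All (λ _ → Piece d) ks) (Λ : Links Ok ρs πs) X → Pointwise SlotAbsorbs X (allSlots ρs) →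
      Σ (All (Branching (lengthOf d)) ks) λ βs →
        innerVertices βs ↭ X ++ (rowVertices (allSlots ρs) ++ (pieceVertices πs ++ linkVertices Λ))
    assemble [] [] [] [] [] = [] , ↭-refl
    assemble {d = d} {ks = (i , j) ∷ _} (ρ ∷ ρs) (π ∷ πs) (((l₁ , l₂ , _ , _ , _ , el₁ , l₁l₂ , l₂f) , (l₃ , l₄ , _ , _ , _ , zl₃ , l₃l₄ , l₄j)) ∷ Λ) X abs
      with X₁ , X₂ , refl , abs₁ , abs₂ ← pointwise-split (slots ρ) abs
      with L , ext , L↭ ← absorb-row (chain ρ) abs₁
      with βs , βs↭ ← assemble ρs πs Λ X₂ abs₂
      = record
        { inner = L ++ Y
        ; path = subst (λ l → Path (branches i) (branches i ∷ l) (branches j)) shape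
            (path-++ (ext (single (branches i))) el₁ (step l₁l₂ (step l₂f (path-++ (Piece.path π) zl₃ (step l₃l₄ (step l₄j (single (branches j))))))))
        ; lower = ≤-trans (+-monoʳ-≤ (q + q * (8 * M) + 4) (Piece.lower π)) (≤-reflexive (≡.sym |inner|))
        ; upper = ≤-trans (≤-reflexive |inner|) (≤-trans (+-monoʳ-≤ (q + q * (8 * M) + 4) (Piece.upper π)) (≤-reflexive (+-suc _ d))) } ∷ βs ,
        ↭-trans (regroup L X₁ (rowVertices (slots ρ)) (l₁ ∷ l₂ ∷ []) (Piece.body π) (l₃ ∷ l₄ ∷ []) (innerVertices βs) X₂ _ _ _ L↭ βs↭)
          (↭-reflexive (cong (λ l → (X₁ ++ X₂) ++ (l ++ ((Piece.body π ++ pieceVertices πs) ++ (l₁ ∷ l₂ ∷ l₃ ∷ l₄ ∷ linkVertices Λ)))) (≡.sym (concatMap-++ slotVertices (slots ρ) (allSlots ρs)))))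
      where
      Y = l₁ ∷ l₂ ∷ (Piece.body π ++ l₃ ∷ l₄ ∷ [])
      shape : L ++ (l₁ ∷ l₂ ∷ (Piece.body π ++ l₃ ∷ l₄ ∷ branches j ∷ [])) ≡ (L ++ Y) ++ [ branches j ]
      shape = ≡.trans (cong (λ l → L ++ (l₁ ∷ l₂ ∷ l)) (≡.sym (++-assoc (Piece.body π) (l₃ ∷ l₄ ∷ []) [ branches j ]))) (≡.sym (++-assoc L Y [ branches j ]))
      |inner| : length (L ++ Y) ≡ q + q * (8 * M) + 4 + length (Piece.body π)
      |inner| = ≡.trans (length-++ L) (≡.trans (cong₂ _+_ (≡.trans (↭-length L↭) (≡.trans (length-++ X₁) (cong₂ _+_ (≡.trans (pointwise-length abs₁) (count ρ)) (rowSize ρ))))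
        (cong (2 +_) (length-++ (Piece.body π)))) (lem (q + q * (8 * M)) (length (Piece.body π))))
        where
        lem : ∀ a b → a + (2 + (b + 2)) ≡ a + 4 + b
        lem = solve-∀

    g≤Nq : g ≤ N * q
    g≤Nq = bound N q (≤-trans (+-monoˡ-≤ (2 * e) (+-monoˡ-≤ (4 * N) 2g≤r₀)) tight)
      where
      2g≤r₀ : 2 * g ≤ r₀
      2g≤r₀ = ≤-trans (≤-reflexive (≡.sym (*-identityˡ (2 * g)))) (*-monoˡ-≤ (2 * g) (≤-trans (s≤s z≤n) (*-monoʳ-≤ 4 0<m)))
      bound : ∀ N q → 2 * g + 4 * N + 2 * e ≤ g + N * (q + 4) → g ≤ N * q
      bound N q h = linear (2 * e) h (lem N q g e)
        where
        lem : ∀ N q g e → g + (g + N * (q + 4)) + 2 * e ≡ N * q + (2 * g + 4 * N + 2 * e)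
        lem = solve-∀

    R-fits : N * (q + 4) ≤ r₀
    R-fits = *-cancelˡ-≤ 4 (≤-trans (m≤m+n _ g) fits)

    |bs| : length bs ≡ t
    |bs| = ≡.trans (length-map branches (allFin t)) (length-allFin t)

    -- The matching needs misses bounded by a quarter of the number of slots, whereas slots were
    -- built relative to the reservoir. The bound `g ≤ N * q` converts one scale into the other.
    few-missed : ∀ x → 2 ^ J * x ≤ r₀ → 4 * x ≤ N * q
    few-missed x h = ≤-trans (*-cancelˡ-≤ (32 * m) {{>-nonZero (≤-trans (s≤s z≤n) (*-monoʳ-≤ 32 0<m))}} (begin
      32 * m * (4 * x)   ≡⟨ lem m x ⟩
      128 * m * x        ≤⟨ *-monoˡ-≤ x J-large ⟩
      2 ^ J * x          ≤⟨ h ⟩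
      4 * m * (2 * g)    ≤⟨ m≤m+n _ (24 * m * g) ⟩
      4 * m * (2 * g) + 24 * m * g ≡⟨ lem₂ m g ⟩
      32 * m * g         ∎)) g≤Nq
      where
      open ≤-Reasoning
      lem : ∀ m x → 32 * m * (4 * x) ≡ 128 * m * x
      lem = solve-∀
      lem₂ : ∀ m g → 4 * m * (2 * g) + 24 * m * g ≡ 32 * m * g
      lem₂ = solve-∀

    record Stock : Set where
      field
        R₀ : List V
        rows : All Row es
        unique₀ : Unique (rowVertices (allSlots rows) ++ (R₀ ++ bs))
        |slots| : length (allSlots rows) ≡ N * q
        |rows| : length (rowVertices (allSlots rows)) ≡ N * q * (8 * M)
        |R₀| : length R₀ ≡ r₀
        good : All (GoodSlot R₀) (allSlots rows)
        ℛ : Reserved (allSlots rows) R₀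

    |reservoir++bs| : ∀ {R₀} → length R₀ ≡ r₀ → length (R₀ ++ bs) ≡ t + r₀
    |reservoir++bs| {R₀} |R₀| = ≡.trans (length-++ R₀) (≡.trans (cong₂ _+_ |R₀| |bs|) (+-comm r₀ t))

    rows-fit : ∀ {R₀} → length R₀ ≡ r₀ → N * q * (8 * M) + length (R₀ ++ bs) ≤ K
    rows-fit {R₀} |R₀| = subst (λ z → N * q * (8 * M) + z ≤ K) (≡.sym (|reservoir++bs| {R₀} |R₀|))
      (subst (_≤ K) (+-comm (t + r₀) (N * q * (8 * M))) budget)

    1≤Nq : 1 ≤ N * q
    1≤Nq = ≤-trans 1≤q (m≤m+n q (length es₀ * q))

    stock-rows : ∀ R₀ → Unique (R₀ ++ bs) → length R₀ ≡ r₀ → (∀ v → g ≤ length (R₀ ∩N v)) →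
      Σ (All Row es) (λ ρs → length (allSlots ρs) ≡ N * q × length (rowVertices (allSlots ρs)) ≡ N * q * (8 * M) ×
        Unique (rowVertices (allSlots ρs) ++ (R₀ ++ bs)) × All (GoodSlot R₀) (allSlots ρs)) → Stock
    stock-rows R₀ uR₀ |R₀| rich (rows , |S| , |SV| , uS , good) = record
      { R₀ = R₀ ; rows = rows ; unique₀ = uS ; |slots| = |S| ; |rows| = |SV| ; |R₀| = |R₀| ; good = good
      ; ℛ = reserve (allSlots rows) R₀ (unique-++⁻ˡ R₀ uR₀) |R₀| rich (subst (1 ≤_) (≡.sym |S|) 1≤Nq) good }

    stock-reservoir : ∃[ R₀ ] (Unique (R₀ ++ bs) × length R₀ ≡ r₀ × (∀ v → g ≤ length (R₀ ∩N v))) → Stock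
    stock-reservoir (R₀ , uR₀ , |R₀| , rich) =
      stock-rows R₀ uR₀ |R₀| rich (build-rows es (R₀ ++ bs) R₀ uR₀ (rows-fit {R₀} |R₀|))

    stock : Stock
    stock = stock-reservoir (reservoir uB g (roomy-pick {r₀ + length bs}
      (subst (_≤ K) (≡.trans (+-comm t r₀) (cong (r₀ +_) (≡.sym |bs|))) (≤-trans (m≤m+n (t + r₀) _) budget))) n<2^g)

    module FromStock (st : Stock) where
      open Stock st
      open Reserved ℛ

      rowV used W : List V
      rowV = rowVertices (allSlots rows)
      -- Only `R` and not `R₀` counts as used, which returns the discarded reservoir vertices to
      -- `W`.
      used = bs ++ (rowV ++ R)
      W = avoid used (allFin n)

      unique-used : Unique used
      unique-used = unique-++ uB (unique-++ (unique-++⁻ˡ rowV unique₀) unique (λ i j → unique-disjoint rowV unique₀ i (∈-++⁺ˡ (⊆R₀ j)))) disjoint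
        where
        disjoint : ∀ {z} → z ∈ bs → z ∉ rowV ++ R
        disjoint z∈bs z∈ with ∈-++⁻ rowV z∈
        ... | inj₁ i = unique-disjoint rowV unique₀ i (∈-++⁺ʳ R₀ z∈bs)
        ... | inj₂ i = unique-disjoint R₀ (unique-++⁻ʳ rowV unique₀) (⊆R₀ i) z∈bs

      |used|≤K : length used ≤ K
      |used|≤K = ≤-trans (≤-reflexive (≡.trans (length-++ bs) (cong₂ _+_ |bs| (≡.trans (length-++ rowV) (cong₂ _+_ |rows| size)))))
        (≤-trans (≤-trans (+-monoʳ-≤ t (+-monoʳ-≤ (N * q * (8 * M)) R-fits)) (≤-reflexive (lem t (N * q * (8 * M)) r₀))) budget)
        where
        lem : ∀ t a r → t + (a + r) ≡ t + r + a
        lem = solve-∀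

      uW : Unique W
      uW = UniqueP.filter⁺ (_∉? used) (UniqueP.allFin⁺ n)

      -- By `roomy` every degree is at least `2 * (K + 2 * e)`, and `used` removes at most `K`
      -- neighbours. At least `K + 4 * e` remain, and `e` is positive.
      dense : ∀ v → 3 * e + 1 ≤ length (W ∩N v)
      dense v = arith e K (length (nbrs v)) (length (W ∩N v)) (length used) (proj₁ joined)
        (*-cancelˡ-≤ m {{>-nonZero 0<m}} (≤-trans (≤-reflexive (lem m (K + 2 * e))) (≤-trans roomy (mindeg′ v))))
        (≤-trans (avoid-length used (unique-nbrs v)) (+-monoˡ-≤ (length used) (unique-⊆-length (UniqueP.filter⁺ (_∉? used) (unique-nbrs v))
          (λ i → let j , z∉ = avoid-⁻ used (nbrs v) i ; z∈ , vz = ∩N-⁻ (allFin n) j in ∈-filter⁺ (edge? v) (∈-filter⁺ (_∉? used) z∈ z∉) vz))))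
        |used|≤K
        where
        lem : ∀ m x → m * (2 * x) ≡ 2 * m * x
        lem = solve-∀
        arith : ∀ e K d w u → 1 ≤ e → 2 * (K + 2 * e) ≤ d → d ≤ w + u → u ≤ K → 3 * e + 1 ≤ w
        arith e K d w u h₁ h₂ h₃ h₄ = linear K (+-mono-≤ (+-mono-≤ h₁ h₂) (+-mono-≤ h₃ h₄)) (lem′ e K d w u)
          where
          lem′ : ∀ e K d w u → 3 * e + 1 + (e + d + (w + u + K)) + K ≡ w + (1 + 2 * (K + 2 * e) + (d + u))
          lem′ = solve-∀

      N≤|W| : N ≤ length W
      N≤|W| = arith n K (length W) (length used) N 2K≤n (subst (_≤ length W + length used) (length-allFin n) (avoid-length used (UniqueP.allFin⁺ n))) |used|≤K N≤K
        where
        N≤K : N ≤ K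
        N≤K = ≤-trans (≤-trans (m≤m*n N (q + 4) {{>-nonZero (≤-trans 1≤q (m≤m+n q 4))}}) R-fits) (≤-trans (m≤n+m r₀ t) (≤-trans (m≤m+n _ _) budget))
        2K≤n : 2 * K ≤ n
        2K≤n = ≤-trans (*-mono-≤ (≤-trans (≤-reflexive (≡.sym (*-identityʳ 2))) (*-monoʳ-≤ 2 0<m)) (m≤m+n K (2 * e))) roomy
        arith : ∀ n K w u N → 2 * K ≤ n → n ≤ w + u → u ≤ K → N ≤ K → N ≤ w
        arith n K w u N h₁ h₂ h₃ h₄ = linear 0 (+-mono-≤ (+-mono-≤ h₁ h₂) (+-mono-≤ h₃ h₄)) (lem n K w u N)
          where
          lem : ∀ n K w u N → N + (n + (w + u) + (K + K)) + 0 ≡ w + (2 * K + n + (u + N))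
          lem = solve-∀

      Pieces : Set
      Pieces = ∃[ d ] Σ (All (λ _ → Piece d) es) λ πs → pieceVertices πs ↭ W

      cut-equally : ∀ {a P z} → Path a P z → P ↭ W → ∀ d r → length W ≡ N * suc d + r → r ≤ N → Pieces
      cut-equally p P↭W d r eq r≤N =
        let πs , πs≡ = cut-pieces e₀ es₀ d r p (≡.trans (↭-length P↭W) eq) r≤N
        in suc d , πs , ↭-trans (↭-reflexive πs≡) P↭W

      pieces : Pieces
      pieces =
        let _ , P , _ , p , P↭W = Hamiltonian.hamilton-path G m e joined 1≤n mindeg W uW dense (≤-trans (s≤s z≤n) N≤|W|)
            d , r , eq , r≤N = divide (length W) (length es₀) N≤|W|
        in cut-equally p P↭W d r eq r≤N

      Spanned : List V → Set
      Spanned L = Unique (bs ++ L) × (∀ v → v ∈ bs ++ L)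

      everything : ∀ v → v ∈ used ++ W
      everything v with v ∈? used
      ... | yes i = ∈-++⁺ˡ i
      ... | no v∉ = ∈-++⁺ʳ used (∈-filter⁺ (_∉? used) (∈-allFin v) v∉)

      spanned : ∀ {L} → bs ++ L ↭ used ++ W → Spanned L
      spanned L↭ = unique-resp (↭-sym L↭) (unique-++ unique-used uW (λ i j → proj₂ (avoid-⁻ used (allFin n) j) i)) ,
        (λ v → ∈-resp-↭ (↭-sym L↭) (everything v))

      finish : ∀ {d} (πs : All (λ _ → Piece d) es) (Λ : Links (_∈ R) rows πs) X → pieceVertices πs ↭ W →
        X ++ linkVertices Λ ↭ R → Pointwise SlotAbsorbs X (allSlots rows) → Σ (All (Branching (lengthOf d)) es) λ βs → Spanned (innerVertices βs)
      finish πs Λ X πs↭W X++Λ abs =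
        let βs , βs↭ = assemble rows πs Λ X abs
        in βs , spanned (↭-trans (++⁺ˡ bs βs↭) (↭-trans (rearrange bs X rowV (pieceVertices πs) (linkVertices Λ))
             (++⁺ (++⁺ˡ bs (++⁺ˡ rowV X++Λ)) πs↭W)))

      x-size : ∀ x N q → x + 4 * N ≡ N * (q + 4) → x ≡ N * q
      x-size x N q eq = +-cancelʳ-≡ (4 * N) x (N * q) (≡.trans eq (lem N q))
        where
        lem : ∀ N q → N * (q + 4) ≡ N * q + 4 * N
        lem = solve-∀

      -- The two bounds on misses have different sources. For a vertex it was enforced by discarding
      -- bad ones; for a slot it holds on all of `R₀`, and so on the part `X`, whichever vertices
      -- the links have taken.
      absorb-remainder : ∀ {X lv} → Unique X → X ++ lv ↭ R → length lv ≡ 4 * N →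
        ∃[ X′ ] (X′ ++ lv ↭ R × Pointwise SlotAbsorbs X′ (allSlots rows))
      absorb-remainder {X} {lv} uX X++lv |lv| =
        let X′ , X′↭X , abs = Matching.perfect-matching slotAbsorbs? X (allSlots rows) (≡.trans |X| (≡.sym |slots|))
              (λ i → few-misses (X⊆R i)) missY
        in X′ , ↭-trans (++⁺ʳ lv X′↭X) X++lv , abs
        where
        X⊆R : ∀ {z} → z ∈ X → z ∈ R
        X⊆R i = ∈-resp-↭ X++lv (∈-++⁺ˡ i)
        |X| : length X ≡ N * q
        |X| = x-size (length X) N q (≡.trans (cong (length X +_) (≡.sym |lv|)) (≡.trans (≡.sym (length-++ X)) (≡.trans (↭-length X++lv) size)))
        missY : ∀ {s} → s ∈ allSlots rows → 4 * length (missed s X) ≤ length (allSlots rows)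
        missY {s} i = ≤-trans (*-monoʳ-≤ 4 (length-filter-mono (λ x → ¬? (slotAbsorbs? x s)) uX (λ j → ⊆R₀ (X⊆R j))))
          (subst (4 * length (missed s R₀) ≤_) (≡.sym |slots|) (few-missed (length (missed s R₀)) (subst (2 ^ J * length (missed s R₀) ≤_) |R₀| (All.lookup good i))))

      remainder-↭ : ∀ lv → Unique lv → (∀ {z} → z ∈ lv → z ∈ R) → avoid lv R ++ lv ↭ R
      remainder-↭ lv ulv lv⊆R = unique-⊆-↭ (unique-++ (UniqueP.filter⁺ (_∉? lv) unique) ulv (λ i → proj₂ (avoid-⁻ lv R i)))
        (λ i → [ (λ j → proj₁ (avoid-⁻ lv R j)) , lv⊆R ]′ (∈-++⁻ (avoid lv R) i))
        (≤-trans (avoid-length lv unique) (≤-reflexive (≡.sym (length-++ (avoid lv R)))))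

      with-links : ∀ {d} (πs : All (λ _ → Piece d) es) (Λ : Links (_∈ R) rows πs) → pieceVertices πs ↭ W →
        Unique (linkVertices Λ ++ []) → length (linkVertices Λ) ≡ 4 * N → Σ (All (Branching (lengthOf d)) es) λ βs → Spanned (innerVertices βs)
      with-links πs Λ πs↭W uΛ |Λ| =
        let X , X++Λ , abs = absorb-remainder (UniqueP.filter⁺ (_∉? linkVertices Λ) unique)
              (remainder-↭ (linkVertices Λ) (unique-++⁻ˡ (linkVertices Λ) uΛ) (links-ok Λ)) |Λ|
        in finish πs Λ X πs↭W X++Λ abs

      with-pieces : Pieces → ∃[ lo ] Σ (All (Branching lo) es) λ βs → Spanned (innerVertices βs)
      with-pieces (d , πs , πs↭W) =
        let Λ , uΛ , |Λ| = build-links ℛ rows πs [] [] ≤-refl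
        in lengthOf d , with-links πs Λ πs↭W uΛ |Λ|

    system : ∃[ lo ] Σ (All (Branching lo) es) λ βs → Unique (bs ++ innerVertices βs) × (∀ v → v ∈ bs ++ innerVertices βs)
    system = FromStock.with-pieces stock (FromStock.pieces stock)

  -- From path systems to subdivisions

  -- A branching path is looked up by a proof that its pair is listed. Covering a vertex yields one
  -- such proof and the subdivision uses another; they must select the same path.
  unique⇒∈-irrelevant : ∀ {a} {A : Set a} {x : A} {xs} → Unique xs → (p q : x ∈ xs) → p ≡ q
  unique⇒∈-irrelevant u (here p)  (here q)  = cong here (uip p q)
  unique⇒∈-irrelevant u (here refl) (there q) = contradiction q (unique-head u)
  unique⇒∈-irrelevant u (there p) (here refl) = contradiction p (unique-head u)
  unique⇒∈-irrelevant u (there p) (there q) = cong there (unique⇒∈-irrelevant (unique-tail u) p q)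

  length-cartesianProduct : ∀ {a b} {A : Set a} {B : Set b} (xs : List A) (ys : List B) →
    length (cartesianProduct xs ys) ≡ length xs * length ys
  length-cartesianProduct [] ys = refl
  length-cartesianProduct (x ∷ xs) ys = ≡.trans (length-++ (map (x ,_) ys)) (cong₂ _+_ (length-map (x ,_) ys) (length-cartesianProduct xs ys))

  record OrderedPairs (t : ℕ) : Set where
    field
      e₀ : Fin t × Fin t
      es₀ : List (Fin t × Fin t)
      unique : Unique (e₀ ∷ es₀)
      complete : ∀ {i j} → i F.< j → (i , j) ∈ e₀ ∷ es₀
      sound : ∀ {i j} → (i , j) ∈ e₀ ∷ es₀ → i F.< j
      few : length (e₀ ∷ es₀) ≤ t * t

  orderedPairs : ∀ t → 2 ≤ t → OrderedPairs t
  orderedPairs (suc zero) (s≤s ())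
  orderedPairs t@(suc (suc _)) _ = from es refl
    where
    lt? : (ij : Fin t × Fin t) → Dec (proj₁ ij F.< proj₂ ij)
    lt? (i , j) = i F.<? j
    all = cartesianProduct (allFin t) (allFin t)
    es = filter lt? all
    complete : ∀ {i j} → i F.< j → (i , j) ∈ es
    complete {i} {j} i<j = ∈-filter⁺ lt? (∈-cartesianProduct⁺ (∈-allFin i) (∈-allFin j)) i<j
    from : ∀ xs → es ≡ xs → OrderedPairs t
    -- As `t ≥ 2`, the pair of the two smallest indices is listed. Nonemptiness matters because the
    -- Hamilton path is divided by the number of pairs.
    from [] eq with () ← subst ((zero , suc zero) ∈_) eq (complete (s≤s z≤n))
    from (e₀ ∷ es₀) eq = record
      { e₀ = e₀ ; es₀ = es₀
      ; unique = subst Unique eq (UniqueP.filter⁺ lt? (UniqueP.cartesianProduct⁺ (UniqueP.allFin⁺ t) (UniqueP.allFin⁺ t)))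
      ; complete = λ {i} {j} i<j → subst ((i , j) ∈_) eq (complete i<j)
      ; sound = λ {i} {j} k → proj₂ (∈-filter⁻ lt? {xs = all} (subst ((i , j) ∈_) (≡.sym eq) k))
      ; few = ≤-trans (≤-reflexive (cong length (≡.sym eq))) (≤-trans (length-filter lt? all)
          (≤-reflexive (≡.trans (length-cartesianProduct (allFin t) (allFin t)) (cong₂ _*_ (length-allFin t) (length-allFin t))))) }

  module Subdivide {n : ℕ} (G : Graph n) {t : ℕ} (branches : Fin t → Fin n)
    (injective : ∀ {i j} → branches i ≡ branches j → i ≡ j) (pairs : OrderedPairs t) where
    open GraphLemmas G
    open Branchings G branches
    open OrderedPairs pairs
    open Branching

    es : List (Fin t × Fin t)
    es = e₀ ∷ es₀

    inner-⊆ : ∀ {lo ks} (βs : All (Branching lo) ks) {ij} (k : ij ∈ ks) {v} → v ∈ inner (All.lookup βs k) → v ∈ innerVertices βs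
    inner-⊆ (β ∷ βs) (here refl) i = ∈-++⁺ˡ i
    inner-⊆ (β ∷ βs) (there k) i = ∈-++⁺ʳ (inner β) (inner-⊆ βs k i)

    inner-unique : ∀ {lo ks} (βs : All (Branching lo) ks) → Unique (innerVertices βs) → ∀ {ij} (k : ij ∈ ks) → Unique (inner (All.lookup βs k))
    inner-unique (β ∷ βs) u (here refl) = unique-++⁻ˡ (inner β) u
    inner-unique (β ∷ βs) u (there k) = inner-unique βs (unique-++⁻ʳ (inner β) u) k

    inner-disjoint : ∀ {lo ks} (βs : All (Branching lo) ks) → Unique (innerVertices βs) → ∀ {ij ij′ v} (k : ij ∈ ks) (k′ : ij′ ∈ ks) →
      v ∈ inner (All.lookup βs k) → v ∈ inner (All.lookup βs k′) → ij ≡ ij′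
    inner-disjoint (β ∷ βs) u (here refl) (here refl) i j = refl
    inner-disjoint (β ∷ βs) u (here refl) (there k′) i j = ⊥-elim (unique-disjoint (inner β) u i (inner-⊆ βs k′ j))
    inner-disjoint (β ∷ βs) u (there k) (here refl) i j = ⊥-elim (unique-disjoint (inner β) u j (inner-⊆ βs k i))
    inner-disjoint (β ∷ βs) u (there k) (there k′) i j = inner-disjoint βs (unique-++⁻ʳ (inner β) u) k k′ i j

    inner-cover : ∀ {lo ks} (βs : All (Branching lo) ks) {v} → v ∈ innerVertices βs → ∃[ ij ] Σ (ij ∈ ks) λ k → v ∈ inner (All.lookup βs k)
    inner-cover (β ∷ βs) i with ∈-++⁻ (inner β) i
    ... | inj₁ j = _ , here refl , j
    ... | inj₂ j = let ij , k , l = inner-cover βs j in ij , there k , l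

    module _ {lo : ℕ} (βs : All (Branching lo) es) (u : Unique (bs ++ innerVertices βs)) (cover : ∀ v → v ∈ bs ++ innerVertices βs) where

      innerOf : ∀ {i j} → Dec (i F.< j) → List V
      innerOf (yes i<j) = inner (All.lookup βs (complete i<j))
      -- Default value: only increasing pairs of indices carry a branching path.
      innerOf (no _)    = []

      inside-at : ∀ {i j} → i F.< j → Σ ((i , j) ∈ es) λ k → innerOf (i F.<? j) ≡ inner (All.lookup βs k)
      inside-at {i} {j} i<j with i F.<? j
      ... | yes p = complete p , refl
      ... | no ¬p = contradiction i<j ¬p

      subdivision : KSubdivision G t
      subdivision = record
        { branch = branches
        ; branch-injective = injective
        ; internal = λ i j → innerOf (i F.<? j)
        ; path-walk = λ i j i<j → let k , eq = inside-at i<j in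
            subst (λ l → Walk G (branches i ∷ l ++ [ branches j ])) (≡.sym eq) (path-walk′ (path (All.lookup βs k)))
        ; internal-unique = λ i j i<j → let k , eq = inside-at i<j in
            subst Unique (≡.sym eq) (inner-unique βs uI k)
        ; internal-not-branch = λ i j i<j v v∈ k v≡ → let l , eq = inside-at i<j in
            unique-disjoint bs u (subst (_∈ bs) (≡.sym v≡) (∈-map⁺ branches (∈-allFin k))) (inner-⊆ βs l (subst (v ∈_) eq v∈))
        ; internally-disjoint = λ i j i′ j′ i<j i′<j′ v v∈ v∈′ →
            let k , eq = inside-at i<j
                k′ , eq′ = inside-at i′<j′
                same = inner-disjoint βs uI k k′ (subst (v ∈_) eq v∈) (subst (v ∈_) eq′ v∈′)
            in cong proj₁ same , cong proj₂ same }
        where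
        uI = unique-++⁻ʳ bs u

      spanning : Spanning subdivision
      spanning v with ∈-++⁻ bs (cover v)
      ... | inj₁ v∈ = let k , _ , v≡ = ∈-map⁻ branches v∈ in inj₁ (k , ≡.sym v≡)
      ... | inj₂ v∈ =
        let (i , j) , k , v∈k = inner-cover βs v∈
            k′ , eq = inside-at (sound k)
        in inj₂ (i , j , sound k , subst (v ∈_) (≡.sym eq) (subst (λ l → v ∈ inner (All.lookup βs l)) (unique⇒∈-irrelevant unique k k′) v∈k))

      nearly-balanced : NearlyBalanced subdivision
      -- Path lengths exceed the number of inner vertices by one, so they are `lo + 1` or `lo + 2`,
      -- that is `ℓ` or `ℓ + 1`.
      nearly-balanced = suc lo , s≤s z≤n , λ i j i<j → let k , eq = inside-at i<j ; β = All.lookup βs k in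
        ≤-trans (lower β) (≤-trans (≤-reflexive (cong length (≡.sym eq))) (n≤1+n _)) ,
        ≤-trans (s≤s (≤-trans (≤-reflexive (cong length eq)) (upper β))) (≤-reflexive (+-comm 1 (suc lo)))

  -- Choice of the constants

  suc≤2^ : ∀ j → suc j ≤ 2 ^ j
  suc≤2^ zero = ≤-refl
  suc≤2^ (suc j) = ≤-trans (s≤s (suc≤2^ j)) (≤-trans (+-monoˡ-≤ (2 ^ j) (m^n>0 2 j)) (≤-reflexive (cong (2 ^ j +_) (≡.sym (+-identityʳ (2 ^ j))))))

  -- N paths with q slots of M blocks each; at most K vertices are set aside before the Hamilton path is built,
  -- and every vertex has g neighbours in the reservoir.
  record Constants (m n t N e : ℕ) : Set where
    field
      K k J M q g : ℕ
      k≡ : suc k ≡ 4 * m * m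
      M≡ : M ≡ suc k * J
      J-large : 128 * m ≤ 2 ^ J
      roomy : 2 * m * (K + 2 * e) ≤ n
      n<2^g : n < 2 ^ g
      1≤q : 1 ≤ q
      budget : t + 4 * m * (2 * g) + N * q * (8 * M) ≤ K
      fits : 4 * (N * (q + 4)) + g ≤ 4 * (4 * m * (2 * g))
      tight : 4 * m * (2 * g) + 4 * N + 2 * e ≤ g + N * (q + 4)

  module Choice (m : ℕ) (0<m : 0 < m) where

    abstract
      -- `D` is tuned to `roomy`: with `g = 4 * f`, reservoir and rows together take at most
      -- `32 * m * f * (1 + 8 * M)` vertices, and `8 * m` times this is exactly `D * f`. For `J` it
      -- suffices that `2 ^ J` exceeds `J`.
      k J M κ D : ℕ
      k = pred (4 * m * m)
      J = 128 * m
      M = suc k * J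
      κ = 8 * m * (1 + 8 * M)
      D = 32 * m * κ
      k≡ : suc k ≡ 4 * m * m
      k≡ = suc-pred (4 * m * m) {{>-nonZero (*-mono-≤ {1} {4 * m} {1} {m} (≤-trans (s≤s z≤n) (*-monoʳ-≤ 4 0<m)) 0<m)}}
      J-large : 128 * m ≤ 2 ^ J
      J-large = <⇒≤ (suc≤2^ J)
      M≡ : M ≡ suc k * J
      M≡ = refl
      κ≡ : κ ≡ 8 * m * (1 + 8 * M)
      κ≡ = refl
      D≡ : D ≡ 32 * m * κ
      D≡ = refl

    8≤κ : 8 ≤ κ
    8≤κ = ≤-trans (*-mono-≤ (*-monoʳ-≤ 8 0<m) (s≤s (z≤n {8 * M}))) (≤-reflexive (≡.sym κ≡))

    8m≤D : 8 * m ≤ D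
    8m≤D = ≤-trans (≤-trans (*-monoˡ-≤ m (m≤m+n 8 24)) (m≤m*n (32 * m) κ {{>-nonZero (≤-trans (s≤s z≤n) 8≤κ)}})) (≤-reflexive (≡.sym D≡))

    32≤D : 32 ≤ D
    32≤D = ≤-trans (*-mono-≤ (*-monoʳ-≤ 32 0<m) (≤-trans (s≤s z≤n) 8≤κ)) (≤-reflexive (≡.sym D≡))

    -- Everything is measured in units of `f`, the quotient of `n` by `D`. Both `N` and `e` are at
    -- most about `f / 32` up to rounding, hence small beside `g = 4 * f`. The summand `32 * D` in
    -- the last hypothesis allows for `e` being a ceiling.
    constants : ∀ n t N e f → 0 < N → D * D ≤ n → D * f ≤ n → n < D * suc f → 1 ≤ t →
      N ≤ t * t → 32 * D * (t * t) ≤ n → 32 * D * e ≤ n + 32 * D → Constants m n t N e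
    constants n t N@(suc _) e f 0<N large f≤ f> 1≤t N≤ t-small e-small = record
      { K = t + r₀ + r₀ * (8 * M) ; k = k ; J = J ; M = M ; q = q ; g = 4 * f
      ; k≡ = k≡ ; M≡ = M≡ ; J-large = J-large
      ; roomy = *-cancelˡ-≤ 4 roomy₄
      ; n<2^g = n<2^g
      ; 1≤q = 1≤q
      ; budget = +-monoʳ-≤ (t + r₀) (*-monoˡ-≤ (8 * M) Nq≤r₀)
      ; fits = ≤-trans (≤-reflexive (≡.sym (*-distribˡ-+ 4 (N * (q + 4)) f))) (*-monoʳ-≤ 4 (subst (N * (q + 4) + f ≤_) y+f (+-monoˡ-≤ f N*≤y)))
      ; tight = subst (λ r → r + 4 * N + 2 * e ≤ 4 * f + N * (q + 4)) y+f (arith₂ N e f y (N * (q + 4)) y≤N* slack) }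
      where
      r₀ = 4 * m * (2 * (4 * f))
      instance
        _ = >-nonZero (≤-trans (s≤s (z≤n {31})) 32≤D)
      D≤f : D ≤ f
      D≤f = ≤-pred (*-cancelˡ-< D D (suc f) (≤-<-trans large f>))
      32≤f : 32 ≤ f
      32≤f = ≤-trans 32≤D D≤f
      32N≤ : 32 * N ≤ suc f
      32N≤ = *-cancelˡ-≤ D (≤-trans (*-monoʳ-≤ D (*-monoʳ-≤ 32 N≤)) (≤-trans (≤-reflexive (lem D (t * t))) (≤-trans t-small (<⇒≤ f>))))
        where
        lem : ∀ D x → D * (32 * x) ≡ 32 * D * x
        lem = solve-∀
      32e≤ : 32 * e ≤ suc f + 32
      32e≤ = *-cancelˡ-≤ D (≤-trans (≤-reflexive (lem D e)) (≤-trans e-small (≤-trans (+-monoˡ-≤ (32 * D) (<⇒≤ f>)) (≤-reflexive (lem₂ D f)))))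
        where
        lem : ∀ D x → D * (32 * x) ≡ 32 * D * x
        lem = solve-∀
        lem₂ : ∀ D f → D * suc f + 32 * D ≡ D * (suc f + 32)
        lem₂ = solve-∀
      -- Of the `g = 4 * f` reservoir neighbours of a vertex, `f` may be lost to the allowance for
      -- bad vertices and `N` to the rounding of `q`; `4 * N` and `2 * e` are what `rich` demands.
      slack : f + 5 * N + 2 * e ≤ 4 * f
      slack = *-cancelˡ-≤ 32 (linear (57 * f + 25) (+-mono-≤ (*-monoʳ-≤ 5 32N≤) (+-mono-≤ (*-monoʳ-≤ 2 32e≤) (*-monoʳ-≤ 32 (≤-trans (s≤s (s≤s (s≤s z≤n))) 32≤f)))) (lem N e f))
        where
        lem : ∀ N e f → 32 * (f + 5 * N + 2 * e) + (5 * suc f + (2 * (suc f + 32) + 32 * f)) + (57 * f + 25) ≡ 32 * (4 * f) + (5 * (32 * N) + (2 * (32 * e) + 32 * 3))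
        lem = solve-∀
      32f≤r₀ : 32 * f ≤ r₀
      32f≤r₀ = ≤-trans (*-monoˡ-≤ f (*-monoʳ-≤ 32 0<m)) (≤-reflexive (lem m f))
        where
        lem : ∀ m f → 32 * m * f ≡ 4 * m * (2 * (4 * f))
        lem = solve-∀
      -- Setting aside `f = g / 4` vertices for the bad ones leaves `y`, shared equally among the
      -- pairs; four vertices of each share go to links and the other `q` to slots.
      y = r₀ ∸ f
      q = y / N ∸ 4
      y+f : y + f ≡ r₀
      y+f = m∸n+n≡m (≤-trans (m≤m+n f (31 * f)) 32f≤r₀)
      5N≤y : 5 * N ≤ y
      5N≤y = arith f N e y r₀ slack 32f≤r₀ y+f
        where
        arith : ∀ f N e y r → f + 5 * N + 2 * e ≤ 4 * f → 32 * f ≤ r → y + f ≡ r → 5 * N ≤ y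
        arith f N e y r h₁ h₂ refl = linear (28 * f + 2 * e) (+-mono-≤ h₁ h₂) (lem f N e y)
          where
          lem : ∀ f N e y → 5 * N + (4 * f + (y + f)) + (28 * f + 2 * e) ≡ y + (f + 5 * N + 2 * e + 32 * f)
          lem = solve-∀
      5≤y/N : 5 ≤ y / N
      5≤y/N = ≤-trans (≤-reflexive (≡.sym (m*n/n≡m 5 N))) (/-monoˡ-≤ N 5N≤y)
      q+4 : q + 4 ≡ y / N
      q+4 = m∸n+n≡m (≤-trans (n≤1+n 4) 5≤y/N)
      N*≤y : N * (q + 4) ≤ y
      N*≤y = ≤-trans (≤-reflexive (≡.trans (cong (N *_) q+4) (*-comm N (y / N)))) (m/n*n≤m y N)
      y≤N* : y ≤ N * (q + 4) + N
      y≤N* = ≤-trans (≤-reflexive (≡.trans (m≡m%n+[m/n]*n y N) (+-comm (y % N) _)))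
        (+-mono-≤ (≤-reflexive (≡.trans (*-comm (y / N) N) (cong (N *_) (≡.sym q+4)))) (<⇒≤ (m%n<n y N)))
      Nq≤r₀ : N * q ≤ r₀
      Nq≤r₀ = ≤-trans (*-monoʳ-≤ N (m≤m+n q 4)) (≤-trans N*≤y (m∸n≤m r₀ f))
      1≤q : 1 ≤ q
      1≤q = +-cancelʳ-≤ 4 1 q (≤-trans 5≤y/N (≤-reflexive (≡.sym q+4)))
      -- Here `n` must be large: `D * D ≤ n` gives `D ≤ f`, so that `n < D * suc f` is at most
      -- `2 ^ f * 2 ^ f`.
      n<2^g : n < 2 ^ (4 * f)
      n<2^g = <-≤-trans f> (≤-trans (*-mono-≤ (≤-trans D≤f (≤-trans (n≤1+n f) (suc≤2^ f))) (suc≤2^ f))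
        (≤-trans (≤-reflexive (≡.sym (^-distribˡ-+-* 2 f f))) (^-monoʳ-≤ 2 (+-monoʳ-≤ f (m≤m+n f (2 * f))))))
      32D≤n : 32 * D ≤ n
      32D≤n = ≤-trans (*-monoˡ-≤ D 32≤D) large
      16De≤n : 16 * D * e ≤ n
      16De≤n = *-cancelˡ-≤ 2 (≤-trans (≤-reflexive (lem D e)) (≤-trans e-small (≤-trans (+-monoʳ-≤ n 32D≤n) (≤-reflexive (cong (n +_) (≡.sym (+-identityʳ n)))))))
        where
        lem : ∀ D e → 2 * (16 * D * e) ≡ 32 * D * e
        lem = solve-∀
      m≤D : m ≤ D
      m≤D = ≤-trans (m≤m+n m (7 * m)) 8m≤D
      8mt≤n : 8 * m * t ≤ n
      8mt≤n = ≤-trans (*-mono-≤ (≤-trans 8m≤D (m≤m+n D (31 * D))) (m≤m*n t t {{>-nonZero 1≤t}})) t-small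
      roomy₄ : 4 * (2 * m * (t + r₀ + r₀ * (8 * M) + 2 * e)) ≤ 4 * n
      roomy₄ = begin
        4 * (2 * m * (t + r₀ + r₀ * (8 * M) + 2 * e))                        ≡⟨ lem m t f M e ⟩
        8 * m * t + 32 * m * (8 * m * (1 + 8 * M)) * f + 16 * m * e          ≡⟨ cong (λ z → 8 * m * t + 32 * m * z * f + 16 * m * e) κ≡ ⟨
        8 * m * t + 32 * m * κ * f + 16 * m * e                              ≡⟨ cong (λ z → 8 * m * t + z * f + 16 * m * e) D≡ ⟨
        8 * m * t + D * f + 16 * m * e                                       ≤⟨ +-mono-≤ (+-mono-≤ 8mt≤n f≤) (≤-trans (*-monoˡ-≤ e (*-monoʳ-≤ 16 m≤D)) 16De≤n) ⟩
        n + n + n                                                             ≤⟨ m≤m+n (n + n + n) n ⟩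
        n + n + n + n                                                         ≡⟨ lem₂ n ⟩
        4 * n                                                                 ∎
        where
        open ≤-Reasoning
        lem : ∀ m t f M e → 4 * (2 * m * (t + 4 * m * (2 * (4 * f)) + 4 * m * (2 * (4 * f)) * (8 * M) + 2 * e)) ≡
          8 * m * t + 32 * m * (8 * m * (1 + 8 * M)) * f + 16 * m * e
        lem = solve-∀
        lem₂ : ∀ n → n + n + n + n ≡ 4 * n
        lem₂ = solve-∀
      arith₂ : ∀ N e f y x → y ≤ x + N → f + 5 * N + 2 * e ≤ 4 * f → y + f + 4 * N + 2 * e ≤ 4 * f + x
      arith₂ N e f y x h₁ h₂ = linear 0 (+-mono-≤ h₁ h₂) (lem N e f y x)
        where
        lem : ∀ N e f y x → y + f + 4 * N + 2 * e + (x + N + 4 * f) + 0 ≡ 4 * f + x + (y + (f + 5 * N + 2 * e))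
        lem = solve-∀

  module Combine {n : ℕ} (G : Graph n) (m e : ℕ) (joined : Joined G e) (1≤n : 1 ≤ n) (mindeg : ∀ v → n ≤ m * degree G v)
    {t : ℕ} (t≤n : t ≤ n) where

    branches : Fin t → Fin n
    branches i = inject≤ i t≤n

    branches-injective : ∀ {i j} → branches i ≡ branches j → i ≡ j
    branches-injective = Fin.inject≤-injective t≤n t≤n _ _

    uB : Unique (map branches (allFin t))
    uB = UniqueP.map⁺ branches-injective (UniqueP.allFin⁺ t)

    open Branchings G branches

    module _ (pairs : OrderedPairs t) where
      open OrderedPairs pairs
      open Subdivide G branches branches-injective pairs using (subdivision; spanning; nearly-balanced)

      Conclusion : Set
      Conclusion = Σ (KSubdivision G t) λ S → Spanning S × NearlyBalanced S

      conclude : (∃[ lo ] Σ (All (Branching lo) (e₀ ∷ es₀)) λ βs → Unique (bs ++ innerVertices βs) × (∀ v → v ∈ bs ++ innerVertices βs)) → Conclusion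
      conclude (lo , βs , u , cover) = subdivision βs u cover , spanning βs u cover , nearly-balanced βs u cover

      from-constants : Constants m n t (suc (length es₀)) e → Conclusion
      from-constants C = conclude (Assembly.system G m e joined 1≤n mindeg branches e₀ es₀ uB
        K roomy k J M q g k≡ M≡ J-large n<2^g 1≤q budget fits tight)
        where open Constants C

  module Final (m : ℕ) (0<m : 0 < m) where
    open Choice m 0<m

    combinatorial : ∀ n → D * D ≤ n → ∀ (G : Graph n) e → Joined G e → 32 * D * e ≤ n + 32 * D → (∀ v → n ≤ m * degree G v) →
      ∀ t → 2 ≤ t → 32 * D * (t * t) ≤ n → Σ (KSubdivision G t) λ S → Spanning S × NearlyBalanced S
    combinatorial n large G e joined e-small mindeg t 2≤t t-small =
      Combine.from-constants G m e joined 1≤n mindeg t≤n pairs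
        (constants n t _ e f (s≤s z≤n) large (≤-trans (≤-reflexive (*-comm D f)) (m/n*n≤m n D)) n<D*suc 1≤t (OrderedPairs.few pairs) t-small e-small)
      where
      pairs = orderedPairs t 2≤t
      instance
        D≢0 = >-nonZero (≤-trans (s≤s (z≤n {31})) 32≤D)
      f = n / D
      1≤t : 1 ≤ t
      1≤t = ≤-trans (s≤s z≤n) 2≤t
      t≤n : t ≤ n
      t≤n = ≤-trans (m≤m*n t t {{>-nonZero 1≤t}}) (≤-trans (≤-trans (m≤m*n (t * t) (32 * D) {{m*n≢0 32 D}}) (≤-reflexive (*-comm (t * t) (32 * D)))) t-small)
      1≤n : 1 ≤ n
      1≤n = ≤-trans 1≤t t≤n
      n<D*suc : n < D * suc f
      n<D*suc = ≤-trans (s≤s (≤-reflexive (m≡m%n+[m/n]*n n D))) (≤-trans (+-monoˡ-≤ (n / D * D) (m%n<n n D)) (≤-reflexive (*-comm (suc f) D)))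

open import Data.Nat using (ℕ; _≥_; _≤_)
open import Data.Integer using (+_; ∣_∣)
open import Data.Rational using (ℚ; 0ℚ; 1ℚ; _<_; _*_; _/_; ceiling)
import Data.Rational as Q
open import Data.Product using (Σ; _×_)
open import Data.Nat using (zero; suc; z≤n; s≤s; >-nonZero)
import Data.Nat as ℕ
import Data.Nat.Properties as ℕ
import Data.Nat.DivMod as ℕ
open import Data.Nat.Coprimality using (1-coprimeTo)
open import Data.Nat.Tactic.RingSolver using (solve-∀)
open import Data.Integer using (-[1+_])
import Data.Integer as ℤ
import Data.Integer.Properties as ℤ
open import Data.Rational using (mkℚ; toℚᵘ; *<*; *≤*)
import Data.Rational.Properties as Q
import Data.Rational.Unnormalised as ℚᵘ
open import Data.Rational.Unnormalised using (mkℚᵘ; *≡*; _≃_)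
import Data.Rational.Unnormalised.Properties as ℚᵘ
open import Data.Product using (_,_)
open import Relation.Nullary using (contradiction)
open import Relation.Binary.PropositionalEquality as ≡ using (_≡_; refl; cong; subst)

-- Rational parameters

integer : ∀ k → toℚᵘ (+ k / 1) ≃ mkℚᵘ (+ k) 0
integer k = Q.toℚᵘ-fromℚᵘ (mkℚᵘ (+ k) 0)

unitFraction : ℕ → ℚ
unitFraction d = mkℚ (+ 1) d (1-coprimeTo (suc d))

0<unitFraction : ∀ d → 0ℚ < unitFraction d
0<unitFraction d = *<* (ℤ.+<+ (s≤s z≤n))

unitFraction≤1 : ∀ d → unitFraction d Q.≤ 1ℚ
unitFraction≤1 d = *≤* (ℤ.+≤+ (s≤s z≤n))

-- A ceiling is the negated floor of the negated fraction, so a negative numerator is divided here;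
-- a nonzero remainder then rounds away from zero, which costs one.
∣neg/∣≤ : ∀ a b → ∣ ℤ.-[1+ a ] ℤ./ℕ suc b ∣ ≤ suc (suc a ℕ./ suc b)
∣neg/∣≤ a b with suc a ℕ.% suc b
... | zero  = ℕ.≤-trans (ℕ.≤-reflexive (ℤ.∣-i∣≡∣i∣ (+ (suc a ℕ./ suc b)))) (ℕ.n≤1+n _)
... | suc _ = ℕ.≤-refl

∣ceiling∣≤ : ∀ x a → Q.↥ x ≡ + a → ∣ ceiling x ∣ ≤ suc (a ℕ./ suc (ℚ.denominator-1 x))
∣ceiling∣≤ (mkℚ _ d _) zero refl = z≤n
∣ceiling∣≤ (mkℚ _ d _) (suc a) refl = ℕ.≤-trans (ℕ.≤-reflexive (≡.trans (ℤ.∣-i∣≡∣i∣ ((+ 1) ℤ.* (-[1+ a ] ℤ./ℕ suc d)))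
  (cong ∣_∣ (ℤ.*-identityˡ (-[1+ a ] ℤ./ℕ suc d))))) (∣neg/∣≤ a d)

-- The rational `x` is in lowest terms while `n / suc d` need not be. Cross-multiplication with the
-- equivalence compares them without a common divisor.
ceiling-fraction : ∀ x n d → toℚᵘ x ≃ mkℚᵘ (+ n) d → suc d ℕ.* ∣ ceiling x ∣ ≤ n ℕ.+ suc d
ceiling-fraction (mkℚ -[1+ a ] b cop) n d (*≡* eq) = contradiction (≡.trans eq (≡.sym (ℤ.pos-* n (suc b)))) λ ()
ceiling-fraction x@(mkℚ (+ a) b cop) n d (*≡* eq) = ℕ.*-cancelˡ-≤ (suc b) (begin
  suc b ℕ.* (suc d ℕ.* ∣ ceiling x ∣)           ≤⟨ ℕ.*-monoʳ-≤ (suc b) (ℕ.*-monoʳ-≤ (suc d) (∣ceiling∣≤ x a refl)) ⟩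
  suc b ℕ.* (suc d ℕ.* suc (a ℕ./ suc b))       ≡⟨ lem (suc b) (suc d) (a ℕ./ suc b) ⟩
  suc d ℕ.* (a ℕ./ suc b ℕ.* suc b) ℕ.+ suc b ℕ.* suc d  ≤⟨ ℕ.+-monoˡ-≤ _ (ℕ.*-monoʳ-≤ (suc d) (ℕ.m/n*n≤m a (suc b))) ⟩
  suc d ℕ.* a ℕ.+ suc b ℕ.* suc d               ≡⟨ cong (ℕ._+ suc b ℕ.* suc d) (≡.trans (ℕ.*-comm (suc d) a) aE≡nb) ⟩
  n ℕ.* suc b ℕ.+ suc b ℕ.* suc d               ≡⟨ lem₂ n (suc b) (suc d) ⟩
  suc b ℕ.* (n ℕ.+ suc d)                       ∎)
  where
  open ℕ.≤-Reasoning
  aE≡nb : a ℕ.* suc d ≡ n ℕ.* suc b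
  aE≡nb = ℤ.+-injective (≡.trans (ℤ.pos-* a (suc d)) (≡.trans eq (≡.sym (ℤ.pos-* n (suc b)))))
  lem : ∀ b d q → b ℕ.* (d ℕ.* suc q) ≡ d ℕ.* (q ℕ.* b) ℕ.+ b ℕ.* d
  lem = solve-∀
  lem₂ : ∀ n b d → n ℕ.* b ℕ.+ b ℕ.* d ≡ b ℕ.* (n ℕ.+ d)
  lem₂ = solve-∀

*-integer : ∀ p n → toℚᵘ (p * (+ n / 1)) ≃ toℚᵘ p ℚᵘ.* mkℚᵘ (+ n) 0
*-integer p n = ℚᵘ.≃-trans (Q.toℚᵘ-homo-* p (+ n / 1)) (ℚᵘ.*-congˡ {toℚᵘ p} (integer n))

ceiling-unitFraction : ∀ d n → suc d ℕ.* ∣ ceiling (unitFraction d * (+ n / 1)) ∣ ≤ n ℕ.+ suc d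
ceiling-unitFraction d n = ceiling-fraction (unitFraction d * (+ n / 1)) n d
  (ℚᵘ.≃-trans (*-integer (unitFraction d) n) (*≡* (lem (+ n) (+ suc d))))
  where
  lem : ∀ x y → (+ 1) ℤ.* x ℤ.* y ≡ x ℤ.* (y ℤ.* + 1)
  lem x y = ≡.trans (cong (ℤ._* y) (ℤ.*-identityˡ x)) (cong (x ℤ.*_) (≡.sym (ℤ.*-identityʳ y)))

-- A positive rational is at least the reciprocal of its denominator, so the denominator of `μ`
-- serves as `m`.
min-degree-ℕ : ∀ μ → 0ℚ < μ → ∀ n δ → μ * (+ n / 1) Q.≤ (+ δ / 1) → n ≤ Q.↧ₙ μ ℕ.* δ
min-degree-ℕ (mkℚ (+ zero) d cop) (*<* (ℤ.+<+ ()))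
min-degree-ℕ μ@(mkℚ (+ suc p) d cop) _ n δ h
  with ℚᵘ.*≤* h′ ← ℚᵘ.≤-respˡ-≃ (*-integer μ n) (ℚᵘ.≤-respʳ-≃ (integer δ) (Q.toℚᵘ-mono-≤ h))
  = ℕ.≤-trans (ℕ.m≤m+n n (p ℕ.* n)) (ℕ.≤-trans (ℤ.drop‿+≤+ (ℤ.≤-trans (ℤ.≤-reflexive (≡.trans (ℤ.pos-* (suc p) n) (≡.sym (ℤ.*-identityʳ _))))
      (ℤ.≤-trans h′ (ℤ.≤-reflexive (≡.sym (≡.trans (ℤ.pos-* δ (suc d)) (cong ((+ δ) ℤ.*_) (cong +_ (≡.sym (ℕ.*-identityʳ (suc d)))))))))))
      (ℕ.≤-reflexive (ℕ.*-comm δ (suc d))))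

square-ℕ : ∀ d n x → (+ x / 1) Q.≤ unitFraction d * unitFraction d * (+ n / 1) → suc d ℕ.* suc d ℕ.* x ≤ n
square-ℕ d n x h
  with ℚᵘ.*≤* h′ ← ℚᵘ.≤-respˡ-≃ (integer x) (ℚᵘ.≤-respʳ-≃ (ℚᵘ.≃-trans (*-integer (unitFraction d * unitFraction d) n)
         (ℚᵘ.*-congʳ {mkℚᵘ (+ n) 0} (Q.toℚᵘ-homo-* (unitFraction d) (unitFraction d)))) (Q.toℚᵘ-mono-≤ h))
  = ℤ.drop‿+≤+ (ℤ.≤-trans (ℤ.≤-reflexive (≡.trans (cong +_ (lem (suc d ℕ.* suc d) x)) (ℤ.pos-* x (suc d ℕ.* suc d ℕ.* 1))))
      (ℤ.≤-trans h′ (ℤ.≤-reflexive (≡.trans (ℤ.*-identityʳ _) (ℤ.*-identityˡ (+ n))))))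
  where
  lem : ∀ a x → a ℕ.* x ≡ x ℕ.* (a ℕ.* 1)
  lem = solve-∀

theorem1p5 : ∀ (μ : ℚ) → 0ℚ < μ →
    Σ ℚ λ c → Σ ℚ λ ε → Σ ℕ λ n₀ →
    (0ℚ < c) × (c Q.≤ 1ℚ) × (0ℚ < ε) × (ε Q.≤ 1ℚ) ×
    (∀ (n : ℕ) → n ≥ n₀ → ∀ (G : Graph n) →
    Joined G ∣ ceiling (ε * (+ n / 1)) ∣ →
    (∀ v → μ * (+ n / 1) Q.≤ (+ degree G v / 1)) →
    ∀ (t : ℕ) → 2 ≤ t → (+ (t Data.Nat.* t) / 1) Q.≤ c * c * (+ n / 1) →
    Σ (KSubdivision G t) λ S → Spanning S × NearlyBalanced S)
theorem1p5 μ 0<μ =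
  -- Both `c` and `ε` are `1 / (32 * D)`: then `e` is at most `n / (32 * D) + 1`, and `t * t`, which
  -- bounds the number of pairs, is at most `n / (32 * D)`. The threshold `D * D` is what makes the
  -- reservoir parameter exceed the logarithm of `n`.
  unitFraction p , unitFraction p , D ℕ.* D , 0<unitFraction p , unitFraction≤1 p , 0<unitFraction p , unitFraction≤1 p ,
  λ n large G joined mindeg t 2≤t t-small →
    combinatorial n large G _ joined
      (subst (λ k → k ℕ.* ∣ ceiling (unitFraction p * (+ n / 1)) ∣ ≤ n ℕ.+ k) 32D≡ (ceiling-unitFraction p n))
      (λ v → min-degree-ℕ μ 0<μ n (degree G v) (mindeg v)) t 2≤t
      (ℕ.≤-trans (subst (λ k → k ℕ.* (t ℕ.* t) ≤ suc p ℕ.* suc p ℕ.* (t ℕ.* t)) 32D≡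
        (ℕ.*-monoˡ-≤ (t ℕ.* t) (ℕ.m≤m*n (suc p) (suc p)))) (square-ℕ p n (t ℕ.* t) t-small))
  where
  open Combinatorics.Choice (Q.↧ₙ μ) (s≤s z≤n)
  open Combinatorics.Final (Q.↧ₙ μ) (s≤s z≤n)
  p = ℕ.pred (32 ℕ.* D)
  32D≡ : suc p ≡ 32 ℕ.* D
  32D≡ = ℕ.suc-pred (32 ℕ.* D) {{>-nonZero (ℕ.≤-trans (s≤s z≤n) (ℕ.*-monoʳ-≤ 32 (ℕ.≤-trans (s≤s (z≤n {31})) 32≤D)))}}
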